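{- Let $s\ge1$ and let $S\subseteq\{0,1,\dots,s\}$ be non-empty. Then \[ \ell(S)\le\min\Bigl\{2^s,\ 2\sum_{0\le t\le 2s\tau(S)}\binom st\Bigr\}. \] Furthermore, there is a function $f(k)$ with $f(k)\to0$ as $k\to\infty$ such that $\ell(S)\le 2^{sf(k)}$ for all $s\ge 1$ and all $S\subseteq\{0,\dots,s\}$ with $|S|=k$.
   Context: For a finite non-empty $S\subset\mathbb Z$ and $n\ge1$, $\tau(S,n)=\min\{|T|:T\subseteq\mathbb Z,\ T+S\supseteq\{1,\dots,n\}\}$, and $\tau(S)=\lim_{n\to\infty}\tau(S,n)/n$. A set $T\subseteq\mathbb Z$ is periodic with period $\ell$ if $T+\ell=T$, with density $|T\cap\{0,\dots,\ell-1\}|/\ell$. An optimal periodic covering is a periodic $T$ with $T+S=\mathbb Z$ and density equal to $\tau(S)$ (such $T$ exist). $\ell(S)$ denotes the minimum period of an optimal periodic covering by translates of $S$. -}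

module Defs where

open import Data.Nat as ℕ using (ℕ; zero; suc; NonZero; _^_)
open import Data.Nat.Combinatorics using (_C_)
open import Data.Integer as ℤ using (ℤ; +_; _%ℕ_)
open import Data.Rational as ℚ using (ℚ; 0ℚ; _/_; ∣_∣; _-_)
open import Data.List using (List; length; [])
open import Data.List.Membership.Propositional using (_∈_)
open import Data.List.Relation.Unary.All using (All)
open import Data.List.Relation.Unary.Unique.Propositional using (Unique)
open import Data.Product using (Σ; ∃; _×_; _,_)
open import Relation.Binary.PropositionalEquality using (_≡_)
open import Relation.Nullary using (yes; no; ¬_)
open import Data.Rational.Properties using (_≤?_)

IsShape : ℕ → List ℕ → Set
IsShape s S = Unique S × All (λ x → x ℕ.≤ s) S × ¬ (S ≡ [])

CoversUpTo : List ℕ → ℕ → List ℤ → Set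
CoversUpTo S n T =
  ∀ (i : ℕ) → 1 ℕ.≤ i → i ℕ.≤ n →
    Σ ℤ λ t → Σ ℕ λ x → t ∈ T × x ∈ S × (t ℤ.+ + x ≡ + i)

IsTauN : List ℕ → ℕ → ℕ → Set
IsTauN S n m =
  (Σ (List ℤ) λ T → Unique T × CoversUpTo S n T × length T ≡ m)
  × (∀ (T : List ℤ) → Unique T → CoversUpTo S n T → m ℕ.≤ length T)

IsTau : List ℕ → ℚ → Set
IsTau S r =
  ∀ (ε : ℚ) → 0ℚ ℚ.< ε →
    Σ ℕ λ N → ∀ (n : ℕ) → N ℕ.≤ n → (nz : NonZero n) → ∀ (m : ℕ) → IsTauN S n m →
      ∣ (_/_ (+ m) n {{nz}}) - r ∣ ℚ.≤ ε

-- A periodic set T ⊆ ℤ with period L (L ≥ 1) is described by its residue set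
-- R ⊆ {0,…,L-1}:  T = { z : z mod L ∈ R }.  Its density is |R|/L.
record PeriodicSet (L : ℕ) : Set where
  field
    residues : List ℕ
    unique   : Unique residues
    bounded  : All (λ x → x ℕ.< L) residues

open PeriodicSet public

_∈ₚ_ : ∀ {L} {{_ : NonZero L}} → ℤ → PeriodicSet L → Set
_∈ₚ_ {L} z T = (z %ℕ L) ∈ residues T

density : ∀ {L} {{_ : NonZero L}} → PeriodicSet L → ℚ
density {L} T = + (length (residues T)) / L

PCovers : ∀ {L} {{_ : NonZero L}} → List ℕ → PeriodicSet L → Set
PCovers S T = ∀ (z : ℤ) → Σ ℤ λ t → Σ ℕ λ x → t ∈ₚ T × x ∈ S × (t ℤ.+ + x ≡ z)

OptimalPeriodicCovering : (S : List ℕ) (L : ℕ) {{_ : NonZero L}} → PeriodicSet L → Set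
OptimalPeriodicCovering S L T = PCovers S T × IsTau S (density T)

HasOptimalPeriod : List ℕ → ℕ → Set
HasOptimalPeriod S L = Σ (NonZero L) λ nz → Σ (PeriodicSet L) λ T →
  OptimalPeriodicCovering S L {{nz}} T

IsEll : List ℕ → ℕ → Set
IsEll S L = HasOptimalPeriod S L × (∀ L′ → HasOptimalPeriod S L′ → L ℕ.≤ L′)

-- Σ_{0 ≤ t ≤ 2 s r} (s choose t)   (t ranges over naturals; only t ≤ s contribute)
binomSumUpTo : ℕ → ℚ → ℕ
binomSumUpTo s r = go s
  where
  term : ℕ → ℕ
  term t with _≤?_ ((+ t) / 1) (((+ (2 ℕ.* s)) / 1) ℚ.* r)
  ... | yes _ = s C t
  ... | no  _ = 0
  go : ℕ → ℕ
  go zero    = term zero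
  go (suc t) = term (suc t) ℕ.+ go t

{-# OPTIONS --safe #-}

-- Covering an integer only involves s + 1 consecutive positions.  Hence, if a periodic covering
-- has the same s-window at two places, it can be cut there into two shorter periodic coverings,
-- one of which is no denser.  So the best density is attained at a period ≤ 2^s, it equals τ(S),
-- and in an optimal covering of least period ℓ(S) the s-windows are pairwise distinct.  By
-- Markov's inequality half of these windows have at most 2sτ(S) elements, whence
-- ℓ(S) ≤ 2 Σ_{t ≤ 2sτ} (s choose t).  For |S| = k ≥ q², a greedy covering of ℤ/(s+1) shows
-- τ(S) ≤ 2/q; with q = j², j ≈ k^(1/4), a Chernoff bound on the binomial sum gives
-- ℓ(S)^j ≤ 2^(7s), that is f(k) = 7/j.
module Submission where

open import Defs
open import Data.Bool using (Bool; true; false; not)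
open import Data.Bool.Properties using () renaming (_≟_ to _≟ᵇ_)
open import Data.Fin.Subset.Properties using (anySubset?)
open import Data.List using (List; []; _∷_; _++_; length; map; filter; upTo; applyUpTo)
open import Data.List.Properties using (length-++; length-map; length-upTo)
open import Data.List.Membership.Propositional using (_∈_; lose; find)
open import Data.List.Membership.Propositional.Properties
open import Data.List.Relation.Unary.All as All using (All)
open import Data.List.Relation.Unary.AllPairs using (_∷_)
open import Data.List.Relation.Unary.Any as Any using (Any; here; there; any?)
open import Data.List.Relation.Unary.Unique.Propositional using (Unique)
open import Data.List.Relation.Unary.Unique.Propositional.Properties using (Unique[x∷xs]⇒x∉xs; upTo⁺; filter⁺; map⁺)
open import Data.Nat
open import Data.Nat.Combinatorics using (_C_; nCk+nC[k+1]≡[n+1]C[k+1])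
open import Data.Nat.DivMod
open import Data.Nat.Induction using (<-rec)
open import Data.Nat.Properties
open import Data.Nat.Tactic.RingSolver using (solve-∀)
open import Data.List.Membership.DecPropositional _≟_ using (_∈?_)
open import Data.Product using (Σ; ∃; _×_; _,_; proj₁; proj₂)
open import Data.Sum using (_⊎_; inj₁; inj₂)
open import Data.Vec using (Vec; []; _∷_)
import Data.Vec.Properties as Vec
open import Function using (_∘_; id)
open import Relation.Binary.Definitions using (tri<; tri≈; tri>)
open import Relation.Binary.PropositionalEquality
open import Relation.Nullary using (yes; no; ¬_; Dec; contradiction; does; _×-dec_; ¬?)
open import Relation.Nullary.Decidable using (map′; dec-true; decidable-stable)

-- Sums and counts

-- Windows of length `s` suffice for cutting: the `s + 1` positions that concern an integer before
-- the cut reach at most `s` positions beyond it, and only these must repeat the beginning of the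
-- piece. τ(S) is a limit of minima whose existence is not given in advance. The combinatorial part
-- therefore never mentions it: it works with a period and a number of positions, and compares
-- densities by cross-multiplication in ℕ. There the optimum is found by finite search, since it is
-- decidable whether a given period admits a covering with a given number of positions. τ(S) enters
-- only afterwards, when finite and periodic coverings are converted into each other with an error
-- independent of n; this also exhibits τ(S) as a rational number.

sumBelow : ℕ → (ℕ → ℕ) → ℕ
sumBelow zero    f = 0
sumBelow (suc n) f = f 0 + sumBelow n (f ∘ suc)

sumBelow-cong : ∀ n {f g} → (∀ i → i < n → f i ≡ g i) → sumBelow n f ≡ sumBelow n g
sumBelow-cong zero    h = refl
sumBelow-cong (suc n) h = cong₂ _+_ (h 0 z<s) (sumBelow-cong n λ i i<n → h (suc i) (s<s i<n))

sumBelow-mono : ∀ n {f g} → (∀ i → i < n → f i ≤ g i) → sumBelow n f ≤ sumBelow n g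
sumBelow-mono zero    h = z≤n
sumBelow-mono (suc n) h = +-mono-≤ (h 0 z<s) (sumBelow-mono n λ i i<n → h (suc i) (s<s i<n))

sumBelow-+ : ∀ n f g → sumBelow n (λ i → f i + g i) ≡ sumBelow n f + sumBelow n g
sumBelow-+ zero    f g = refl
sumBelow-+ (suc n) f g rewrite sumBelow-+ n (f ∘ suc) (g ∘ suc) =
  interchange (f 0) (g 0) (sumBelow n (f ∘ suc)) (sumBelow n (g ∘ suc))
  where
  interchange : ∀ a b c d → a + b + (c + d) ≡ a + c + (b + d)
  interchange = solve-∀

sumBelow-const : ∀ n c → sumBelow n (λ _ → c) ≡ n * c
sumBelow-const zero    c = refl
sumBelow-const (suc n) c = cong (c +_) (sumBelow-const n c)

sumBelow-*ˡ : ∀ n c f → sumBelow n (λ i → c * f i) ≡ c * sumBelow n f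
sumBelow-*ˡ zero    c f = sym (*-zeroʳ c)
sumBelow-*ˡ (suc n) c f =
  trans (cong (c * f 0 +_) (sumBelow-*ˡ n c (f ∘ suc))) (sym (*-distribˡ-+ c (f 0) _))

sumBelow-swap : ∀ m n (f : ℕ → ℕ → ℕ) →
  sumBelow m (λ i → sumBelow n (f i)) ≡ sumBelow n (λ j → sumBelow m (λ i → f i j))
sumBelow-swap zero    n f = sym (trans (sumBelow-const n 0) (*-zeroʳ n))
sumBelow-swap (suc m) n f =
  trans (cong (sumBelow n (f 0) +_) (sumBelow-swap m n (f ∘ suc)))
        (sym (sumBelow-+ n (f 0) (λ j → sumBelow m (λ i → f (suc i) j))))

sumBelow-split : ∀ d e f → sumBelow (d + e) f ≡ sumBelow d f + sumBelow e (f ∘ (d +_))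
sumBelow-split zero    e f = refl
sumBelow-split (suc d) e f =
  trans (cong (f 0 +_) (sumBelow-split d e (f ∘ suc))) (sym (+-assoc (f 0) _ _))

sumBelow-snoc : ∀ n f → sumBelow (suc n) f ≡ sumBelow n f + f n
sumBelow-snoc zero    f = +-comm (f 0) 0
sumBelow-snoc (suc n) f =
  trans (cong (f 0 +_) (sumBelow-snoc n (f ∘ suc))) (sym (+-assoc (f 0) _ _))

sumBelow-rotate : ∀ P f → (∀ i → f (i + P) ≡ f i) → ∀ d → sumBelow P (f ∘ (d +_)) ≡ sumBelow P f
sumBelow-rotate P f per zero    = refl
sumBelow-rotate P f per (suc d) = trans (sumBelow-rotate P (f ∘ suc) (per ∘ suc) d) shift-by-one
  where
  shift-by-one : sumBelow P (f ∘ suc) ≡ sumBelow P f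
  shift-by-one = +-cancelˡ-≡ (f 0) _ _
    (trans (sumBelow-snoc P f) (trans (+-comm _ (f P)) (cong (_+ sumBelow P f) (per 0))))

sumBelow-periods : ∀ P f → (∀ i → f (i + P) ≡ f i) → ∀ k → sumBelow (k * P) f ≡ k * sumBelow P f
sumBelow-periods P f per zero    = refl
sumBelow-periods P f per (suc k) = trans (sumBelow-split P (k * P) f)
  (cong (sumBelow P f +_)
    (trans (sumBelow-cong (k * P) λ i _ → trans (cong f (+-comm P i)) (per i))
           (sumBelow-periods P f per k)))

bit : Bool → ℕ
bit false = 0
bit true  = 1

count : (ℕ → Bool) → ℕ → ℕ
count α n = sumBelow n (bit ∘ α)

support : (ℕ → Bool) → ℕ → List ℕ
support α n = filter (λ i → α i ≟ᵇ true) (upTo n)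

length-support : ∀ α n → length (support α n) ≡ count α n
length-support α n = go id n
  where
  go : ∀ f n → length (filter (λ i → α i ≟ᵇ true) (applyUpTo f n)) ≡ count (α ∘ f) n
  go f zero    = refl
  go f (suc n) with α (f 0)
  ... | true  = cong suc (go (f ∘ suc) n)
  ... | false = go (f ∘ suc) n

count≤n : ∀ α n → count α n ≤ n
count≤n α n = ≤-trans (sumBelow-mono n {g = λ _ → 1} λ i _ → bit≤1 (α i))
                     (≤-reflexive (trans (sumBelow-const n 1) (*-identityʳ n)))
  where
  bit≤1 : ∀ b → bit b ≤ 1
  bit≤1 false = z≤n
  bit≤1 true  = ≤-refl

count-positive : ∀ α n i → i < n → α i ≡ true → 1 ≤ count α n
count-positive α (suc n) zero    _   h rewrite h = s≤s z≤n
count-positive α (suc n) (suc i) i<n h = ≤-trans (count-positive (α ∘ suc) n i (≤-pred i<n) h) (m≤n+m _ _)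

module _ {A B : Set} (f : A → B) where

  -- Pigeonhole: after deleting one occurrence of `f x` from `ys`, injectivity keeps the images of
  -- the other elements in the rest. Injectivity is asked on `xs` only, because windows are distinct
  -- only at places within one period.
  injection⇒length-≤ : ∀ {xs ys} → Unique xs → (∀ {x} → x ∈ xs → f x ∈ ys) →
    (∀ {x y} → x ∈ xs → y ∈ xs → f x ≡ f y → x ≡ y) → length xs ≤ length ys
  injection⇒length-≤ {[]}     _          _   _   = z≤n
  injection⇒length-≤ {x ∷ xs} ux@(_ ∷ u) sub inj with ∈-∃++ (sub (here refl))
  ... | as , bs , refl = begin
    suc (length xs)               ≤⟨ s≤s (injection⇒length-≤ u sub′ λ p q → inj (there p) (there q)) ⟩
    suc (length (as ++ bs))       ≡⟨ cong suc (length-++ as) ⟩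
    suc (length as + length bs)   ≡⟨ +-suc (length as) (length bs) ⟨
    length as + suc (length bs)   ≡⟨ length-++ as ⟨
    length (as ++ f x ∷ bs)       ∎
    where
    open ≤-Reasoning
    sub′ : ∀ {y} → y ∈ xs → f y ∈ as ++ bs
    sub′ {y} y∈xs with ∈-++⁻ as (sub (there y∈xs))
    ... | inj₁ fy∈as         = ∈-++⁺ˡ fy∈as
    ... | inj₂ (here fy≡fx)  = contradiction (subst (_∈ xs) (inj (there y∈xs) (here refl) fy≡fx) y∈xs)
                                             (Unique[x∷xs]⇒x∉xs ux)
    ... | inj₂ (there fy∈bs) = ∈-++⁺ʳ as fy∈bs

-- Windows and light words

window : (ℕ → Bool) → ∀ s → Vec Bool s
window α zero    = []
window α (suc s) = α 0 ∷ window (α ∘ suc) s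

window-injective : ∀ α β s → window α s ≡ window β s → ∀ k → k < s → α k ≡ β k
window-injective α β (suc s) eq zero    _   = Vec.∷-injectiveˡ eq
window-injective α β (suc s) eq (suc k) k<s =
  window-injective (α ∘ suc) (β ∘ suc) s (Vec.∷-injectiveʳ eq) k (≤-pred k<s)

lightWords : ∀ s → ℕ → List (Vec Bool s)
lightWords zero    m       = [] ∷ []
lightWords (suc s) zero    = map (false ∷_) (lightWords s zero)
lightWords (suc s) (suc m) = map (true ∷_) (lightWords s m) ++ map (false ∷_) (lightWords s (suc m))

window∈lightWords : ∀ α s m → count α s ≤ m → window α s ∈ lightWords s m
window∈lightWords α zero    m       h = here refl
window∈lightWords α (suc s) zero    h with α 0
... | false = ∈-map⁺ (false ∷_) (window∈lightWords (α ∘ suc) s zero h)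
window∈lightWords α (suc s) (suc m) h with α 0
... | true  = ∈-++⁺ˡ (∈-map⁺ (true ∷_) (window∈lightWords (α ∘ suc) s m (≤-pred h)))
... | false = ∈-++⁺ʳ (map (true ∷_) (lightWords s m))
                     (∈-map⁺ (false ∷_) (window∈lightWords (α ∘ suc) s (suc m) h))

-- The volume of a Hamming ball of radius `m`, with the recursion on the first letter that
-- `lightWords` has; `ballSize-suc` recovers the sum of binomial coefficients.
ballSize : ℕ → ℕ → ℕ
ballSize zero    m       = 1
ballSize (suc s) zero    = ballSize s zero
ballSize (suc s) (suc m) = ballSize s m + ballSize s (suc m)

length-lightWords : ∀ s m → length (lightWords s m) ≡ ballSize s m
length-lightWords zero    m       = refl
length-lightWords (suc s) zero    = trans (length-map _ (lightWords s zero)) (length-lightWords s zero)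
length-lightWords (suc s) (suc m) = trans (length-++ (map (true ∷_) (lightWords s m)))
  (cong₂ _+_ (trans (length-map _ (lightWords s m)) (length-lightWords s m))
             (trans (length-map _ (lightWords s (suc m))) (length-lightWords s (suc m))))

ballSize-zero : ∀ s → ballSize s 0 ≡ 1
ballSize-zero zero    = refl
ballSize-zero (suc s) = ballSize-zero s

ballSize-suc : ∀ s m → ballSize s (suc m) ≡ s C suc m + ballSize s m
ballSize-suc zero    m       = refl
ballSize-suc (suc s) zero
  rewrite ballSize-suc s 0 | ballSize-zero s | sym (nCk+nC[k+1]≡[n+1]C[k+1] s 0) =
  refl
ballSize-suc (suc s) (suc m)
  rewrite ballSize-suc s (suc m) | ballSize-suc s m | sym (nCk+nC[k+1]≡[n+1]C[k+1] s (suc m)) =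
  rearrange (s C suc m) (ballSize s m) (s C suc (suc m))
  where
  rearrange : ∀ a b c → a + b + (c + (a + b)) ≡ a + c + (b + (a + b))
  rearrange = solve-∀

ballSize≤2^ : ∀ s m → ballSize s m ≤ 2 ^ s
ballSize≤2^ zero    m       = ≤-refl
ballSize≤2^ (suc s) zero    = ≤-trans (ballSize≤2^ s zero) (m≤m+n _ _)
ballSize≤2^ (suc s) (suc m) =
  +-mono-≤ (ballSize≤2^ s m) (≤-trans (ballSize≤2^ s (suc m)) (m≤m+n _ _))

-- A word of weight t ≤ m contributes M^(s − t) ≥ M^(s − m) to the expansion of (1 + M)^s.
ballSize-chernoff : ∀ M .{{_ : NonZero M}} s m → ballSize s m * M ^ s ≤ suc M ^ s * M ^ m
ballSize-chernoff M zero    m = ≤-trans (m^n>0 M m) (≤-reflexive (sym (*-identityˡ (M ^ m))))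
ballSize-chernoff M (suc s) zero = begin
  ballSize s 0 * (M * M ^ s)     ≡⟨ comm (ballSize s 0) M (M ^ s) ⟩
  M * (ballSize s 0 * M ^ s)     ≤⟨ *-mono-≤ (n≤1+n M) (ballSize-chernoff M s 0) ⟩
  suc M * (suc M ^ s * 1)        ≡⟨ *-assoc (suc M) (suc M ^ s) 1 ⟨
  suc M * suc M ^ s * 1          ∎
  where
  open ≤-Reasoning
  comm : ∀ a b c → a * (b * c) ≡ b * (a * c)
  comm = solve-∀
ballSize-chernoff M (suc s) (suc m) = begin
  (ballSize s m + ballSize s (suc m)) * (M * M ^ s)
    ≡⟨ expand (ballSize s m) (ballSize s (suc m)) M (M ^ s) ⟩
  M * (ballSize s m * M ^ s + ballSize s (suc m) * M ^ s)
    ≤⟨ *-monoʳ-≤ M (+-mono-≤ (ballSize-chernoff M s m) (ballSize-chernoff M s (suc m))) ⟩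
  M * (suc M ^ s * M ^ m + suc M ^ s * (M * M ^ m))
    ≡⟨ collect M (suc M ^ s) (M ^ m) ⟩
  suc M * suc M ^ s * (M * M ^ m) ∎
  where
  open ≤-Reasoning
  expand : ∀ a b c d → (a + b) * (c * d) ≡ c * (a * d + b * d)
  expand = solve-∀
  collect : ∀ a b c → a * (b * c + b * (a * c)) ≡ (1 + a) * b * (a * c)
  collect = solve-∀

module _ {Q : ℕ → Set} (Q? : ∀ n → Dec (Q n)) where

  least : ∀ n → Q n → ∃ λ m → Q m × (∀ k → Q k → m ≤ k)
  least n q = go n n ≤-refl q
    where
    go : ∀ b n → n ≤ b → Q n → ∃ λ m → Q m × (∀ k → Q k → m ≤ k)
    go b n n≤b q with anyUpTo? Q? n
    go b       n n≤b q | no ¬q              = n , q , λ k qk → ≮⇒≥ λ k<n → ¬q (k , k<n , qk)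
    go zero    n n≤b q | yes (k , k<n , qk) = contradiction (<-≤-trans k<n n≤b) λ ()
    go (suc b) n n≤b q | yes (k , k<n , qk) = go b k (≤-pred (<-≤-trans k<n n≤b)) qk

-- Periodic coverings

does⇒ : ∀ {A : Set} (a? : Dec A) → does a? ≡ true → A
does⇒ (yes a) _ = a

[i%P+j]%P≡[i+j]%P : ∀ i j P .{{_ : NonZero P}} → (i % P + j) % P ≡ (i + j) % P
[i%P+j]%P≡[i+j]%P i j P = begin
  (i % P + j) % P          ≡⟨ %-distribˡ-+ (i % P) j P ⟩
  (i % P % P + j % P) % P  ≡⟨ cong (λ a → (a + j % P) % P) (m%n%n≡m%n i P) ⟩
  (i % P + j % P) % P      ≡⟨ %-distribˡ-+ i j P ⟨
  (i + j) % P              ∎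
  where open ≡-Reasoning

%-cancelˡ-+ : ∀ i a b P .{{_ : NonZero P}} → a < P → b < P → (i + a) % P ≡ (i + b) % P → a ≡ b
%-cancelˡ-+ i a b P a<P b<P eq = begin
  a                     ≡⟨ recover a a<P ⟨
  ((i + a) % P + j) % P ≡⟨ cong (λ n → (n + j) % P) eq ⟩
  ((i + b) % P + j) % P ≡⟨ recover b b<P ⟩
  b                     ∎
  where
  open ≡-Reasoning
  -- An additive inverse of `i` modulo `P`.
  j = P ∸ i % P
  rearrange : ∀ u v w x → u + w + x + v ≡ x + (v + u + w)
  rearrange = solve-∀
  recover : ∀ c → c < P → ((i + c) % P + j) % P ≡ c
  recover c c<P = begin
    ((i + c) % P + j) % P                 ≡⟨ [i%P+j]%P≡[i+j]%P (i + c) j P ⟩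
    (i + c + j) % P                       ≡⟨ cong (λ n → (n + c + j) % P) (m≡m%n+[m/n]*n i P) ⟩
    (i % P + i / P * P + c + j) % P       ≡⟨ cong (_% P) (rearrange (i % P) j (i / P * P) c) ⟩
    (c + (j + i % P + i / P * P)) % P     ≡⟨ cong (λ n → (c + (n + i / P * P)) % P) (m∸n+n≡m (m%n≤n i P)) ⟩
    (c + suc (i / P) * P) % P             ≡⟨ [m+kn]%n≡m%n c (suc (i / P)) P ⟩
    c % P                                 ≡⟨ m<n⇒m%n≡m c<P ⟩
    c                                     ∎

module Coverings (S : List ℕ) (s : ℕ) where

  -- The position p stands for the integer p − s, so that the integer i is covered by
  -- the translates at the positions i + (s − x), x ∈ S, and no negative number occurs.
  Covers : (ℕ → Bool) → Set
  Covers α = ∀ i → ∃ λ x → x ∈ S × α (i + (s ∸ x)) ≡ true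

  -- `c` is an upper bound for the number of positions per period, not the number itself: this makes
  -- the notion monotone in `c`, so that a generous count is enough to construct a covering.
  record Covering (P c : ℕ) : Set where
    constructor covering
    field
      indicator : ℕ → Bool
      periodic  : ∀ i → indicator (i + P) ≡ indicator i
      covers    : Covers indicator
      count≤c   : count indicator P ≤ c

  open Covering public

  periodic-% : ∀ {P c} (T : Covering P c) .{{_ : NonZero P}} i → indicator T (i % P) ≡ indicator T i
  periodic-% {P} T i =
    trans (sym (go (i / P) (i % P))) (cong (indicator T) (sym (m≡m%n+[m/n]*n i P)))
    where
    go : ∀ k r → indicator T (r + k * P) ≡ indicator T r
    go zero    r = cong (indicator T) (+-identityʳ r)
    go (suc k) r = trans (cong (indicator T) (trans (cong (r +_) (+-comm P (k * P))) (sym (+-assoc r (k * P) P))))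
                         (trans (periodic T (r + k * P)) (go k r))

  periodize : ∀ P .{{_ : NonZero P}} (α : ℕ → Bool) →
    (∀ {i} → i < P → Any (λ x → α ((i + (s ∸ x)) % P) ≡ true) S) → Covering P (count α P)
  periodize P α h = covering (α ∘ (_% P)) (λ i → cong α ([m+n]%n≡m%n i P)) cov
    (≤-reflexive (sumBelow-cong P λ i i<P → cong (bit ∘ α) (m<n⇒m%n≡m i<P)))
    where
    cov : Covers (α ∘ (_% P))
    cov i with find (h (m%n<n i P))
    ... | x , x∈S , eq = x , x∈S , trans (cong α (sym ([i%P+j]%P≡[i+j]%P i (s ∸ x) P))) eq

  weaken : ∀ {P c c′} → c ≤ c′ → Covering P c → Covering P c′
  weaken c≤c′ T = record { Covering T ; count≤c = ≤-trans (count≤c T) c≤c′ }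

  -- `R` may contain repetitions and numbers beyond the period. They only make the count less sharp,
  -- so lists of positions can be concatenated without regard to overlaps.
  fromPositions : ∀ P .{{_ : NonZero P}} (R : List ℕ) →
    (∀ {i} → i < P → Any (λ x → (i + (s ∸ x)) % P ∈ R) S) → Covering P (length R)
  fromPositions P R h = weaken count≤ (periodize P (λ i → does (i ∈? R)) λ i<P →
      Any.map (λ {x} → dec-true (_ ∈? R)) (h i<P))
    where
    α : ℕ → Bool
    α i = does (i ∈? R)
    count≤ : count α P ≤ length R
    count≤ = ≤-trans (≤-reflexive (sym (length-support α P)))
      (injection⇒length-≤ id (filter⁺ (λ i → α i ≟ᵇ true) (upTo⁺ P))
        (λ {i} i∈ → does⇒ (i ∈? R) (proj₂ (∈-filter⁻ (λ i → α i ≟ᵇ true) {xs = upTo P} i∈))) λ _ _ eq → eq)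

  fullCovering : ∀ P .{{_ : NonZero P}} {x} → x ∈ S → Covering P P
  fullCovering P x∈S = weaken (≤-reflexive (length-upTo P))
    (fromPositions P (upTo P) λ {i} _ → lose x∈S (∈-upTo⁺ (m%n<n _ P)))

  private
    vecFn : ∀ {n} → Vec Bool n → ℕ → Bool
    vecFn []      _       = false
    vecFn (b ∷ v) zero    = b
    vecFn (b ∷ v) (suc i) = vecFn v i

    vecFn-window : ∀ n α i → i < n → vecFn (window α n) i ≡ α i
    vecFn-window (suc n) α zero    _   = refl
    vecFn-window (suc n) α (suc i) i<n = vecFn-window n (α ∘ suc) i (≤-pred i<n)

  -- A periodic indicator is determined by its first `P` values, and `periodize` reduces the
  -- covering condition to the integers below `P`: this leaves `2 ^ P` candidates, each tested by a
  -- finite check.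
  covering? : ∀ P .{{_ : NonZero P}} c → Dec (Covering P c)
  covering? P c = map′ to from (anySubset? good?)
    where
    Good : Vec Bool P → Set
    Good v = (∀ {i} → i < P → Any (λ x → vecFn v ((i + (s ∸ x)) % P) ≡ true) S) × count (vecFn v) P ≤ c
    good? : ∀ v → Dec (Good v)
    good? v = allUpTo? (λ i → any? (λ x → vecFn v ((i + (s ∸ x)) % P) ≟ᵇ true) S) P
              ×-dec (count (vecFn v) P ≤? c)
    to : ∃ Good → Covering P c
    to (v , h , le) = weaken le (periodize P (vecFn v) h)
    from : Covering P c → ∃ Good
    from T = window α P , cov , ≤-trans (≤-reflexive (sumBelow-cong P λ i i<P → cong bit (vecFn-window P α i i<P)))
                                        (count≤c T)
      where
      α = indicator T
      cov : ∀ {i} → i < P → Any (λ x → vecFn (window α P) ((i + (s ∸ x)) % P) ≡ true) S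
      cov {i} _ with covers T i
      ... | x , x∈S , eq =
        lose x∈S (trans (vecFn-window P α _ (m%n<n (i + (s ∸ x)) P)) (trans (periodic-% T (i + (s ∸ x))) eq))

  -- Covering the integers 0,…,e − 1 only involves the positions below e + s, where α agrees with its e-periodization.
  close : ∀ e .{{_ : NonZero e}} α → Covers α → (∀ k → k < s → α (k + e) ≡ α k) → Covering e (count α e)
  close e α cov recur = periodize e α closed
    where
    agree : ∀ q r → r + q * e < e + s → α (r + q * e) ≡ α r
    agree zero    r _  = cong α (+-identityʳ r)
    agree (suc q) r lt = trans (cong α eq) (trans (recur (r + q * e) r+qe<s)
                               (agree q r (<-≤-trans r+qe<s (m≤n+m s e))))
      where
      eq : r + (e + q * e) ≡ r + q * e + e
      eq = trans (cong (r +_) (+-comm e (q * e))) (sym (+-assoc r (q * e) e))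
      r+qe<s : r + q * e < s
      r+qe<s = +-cancelˡ-< e _ _ (subst (_< e + s) (trans eq (+-comm _ e)) lt)
    agree-% : ∀ k → k < e + s → α (k % e) ≡ α k
    agree-% k lt = trans (sym (agree (k / e) (k % e) (subst (_< e + s) (m≡m%n+[m/n]*n k e) lt)))
                         (cong α (sym (m≡m%n+[m/n]*n k e)))
    closed : ∀ {i} → i < e → Any (λ x → α ((i + (s ∸ x)) % e) ≡ true) S
    closed {i} i<e with cov i
    ... | x , x∈S , eq = lose x∈S (trans (agree-% (i + (s ∸ x)) (+-mono-<-≤ i<e (m∸n≤m s x))) eq)

  -- Cutting a covering at a repeated window

  shift : ∀ {P c} → ℕ → Covering P c → Covering P c
  shift {P} i T = covering (α ∘ (i +_))
      (λ j → trans (cong α (sym (+-assoc i j P))) (periodic T (i + j)))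
      cov
      (≤-trans (≤-reflexive (sumBelow-rotate P (bit ∘ α) (cong bit ∘ periodic T) i)) (count≤c T))
    where
    α = indicator T
    cov : Covers (α ∘ (i +_))
    cov j with covers T (i + j)
    ... | x , x∈S , eq = x , x∈S , trans (cong α (sym (+-assoc i j (s ∸ x)))) eq

  windowAt : ∀ {P c} → Covering P c → ℕ → Vec Bool s
  windowAt T i = window (indicator T ∘ (i +_)) s

  record Split (P c : ℕ) : Set where
    field
      d e c₁ c₂ : ℕ
      0<d   : 0 < d
      0<e   : 0 < e
      d+e≡P : d + e ≡ P
      c₁+c₂≤c : c₁ + c₂ ≤ c
      first  : Covering d c₁
      second : Covering e c₂

  -- Rotate so that the first occurrence of the window sits at 0 and the second at `d`. The piece
  -- before `d` is followed by the window it starts with. The piece after it is followed by the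
  -- window at `P`, which equals the one at 0 by periodicity and hence the one at `d`. So both
  -- pieces can be closed up.
  split : ∀ {P c} (T : Covering P c) i j → i < j → j < P → windowAt T i ≡ windowAt T j → Split P c
  split {P} {c} T i j i<j j<P eq = record
    { d = d ; e = e ; 0<d = 0<d ; 0<e = 0<e ; d+e≡P = d+e≡P
    ; c₁+c₂≤c = ≤-trans (≤-reflexive (trans (sym (sumBelow-split d e (bit ∘ α)))
                                            (cong (count α) d+e≡P)))
                        (count≤c T′)
    ; first = close d {{>-nonZero 0<d}} α (covers T′) recur₁
    ; second = close e {{>-nonZero 0<e}} (α ∘ (d +_)) (covers (shift d T′)) recur₂
    }
    where
    d = j ∸ i
    e = P ∸ d
    d<P : d < P
    d<P = ≤-<-trans (m∸n≤m j i) j<P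
    0<d : 0 < d
    0<d = m<n⇒0<n∸m i<j
    0<e : 0 < e
    0<e = m<n⇒0<n∸m d<P
    d+e≡P : d + e ≡ P
    d+e≡P = m+[n∸m]≡n (<⇒≤ d<P)
    T′ = shift i T
    α = indicator T′
    recur : ∀ k → k < s → α k ≡ α (d + k)
    recur k k<s = trans
      (window-injective (indicator T ∘ (i +_)) (indicator T ∘ (j +_)) s eq k k<s)
      (cong (indicator T) (trans (cong (_+ k) (sym (m+[n∸m]≡n (<⇒≤ i<j)))) (+-assoc i d k)))
    recur₁ : ∀ k → k < s → α (k + d) ≡ α k
    recur₁ k k<s = trans (cong α (+-comm k d)) (sym (recur k k<s))
    recur₂ : ∀ k → k < s → α (d + (k + e)) ≡ α (d + k)
    recur₂ k k<s = begin
      α (d + (k + e))  ≡⟨ cong α (rearrange d k e) ⟩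
      α (k + (d + e))  ≡⟨ cong (λ n → α (k + n)) d+e≡P ⟩
      α (k + P)        ≡⟨ periodic T′ k ⟩
      α k              ≡⟨ recur k k<s ⟩
      α (d + k)        ∎
      where
      open ≡-Reasoning
      rearrange : ∀ a b c → a + (b + c) ≡ b + (a + c)
      rearrange = solve-∀

  Recurrence : ∀ {P c} → Covering P c → Set
  Recurrence {P} T = ∃ λ i → ∃ λ j → i < j × j < P × windowAt T i ≡ windowAt T j

  recurrence? : ∀ {P c} (T : Covering P c) → Dec (Recurrence T)
  recurrence? {P} T = map′
    (λ (j , j<P , i , i<j , eq) → i , j , i<j , j<P , eq)
    (λ (i , j , i<j , j<P , eq) → j , j<P , i , i<j , eq)
    (anyUpTo? (λ j → anyUpTo? (λ i → Vec.≡-dec _≟ᵇ_ (windowAt T i) (windowAt T j)) j) P)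

  -- The list of places is arbitrary so that the lemma serves twice: with all places and `m = s` for
  -- the bound `2 ^ s`, and with the light places alone for the binomial bound.
  distinctWindows⇒length-≤ : ∀ {P c} (T : Covering P c) → ¬ Recurrence T → ∀ m {is} → Unique is →
    (∀ {i} → i ∈ is → i < P × count (indicator T ∘ (i +_)) s ≤ m) → length is ≤ ballSize s m
  distinctWindows⇒length-≤ T ¬rec m u h =
    ≤-trans (injection⇒length-≤ (windowAt T) u
              (λ i∈ → window∈lightWords (indicator T ∘ (_ +_)) s m (proj₂ (h i∈)))
              λ i∈ j∈ → inj _ _ (proj₁ (h i∈)) (proj₁ (h j∈)))
            (≤-reflexive (length-lightWords s m))
    where
    inj : ∀ i j → i < _ → j < _ → windowAt T i ≡ windowAt T j → i ≡ j
    inj i j i<P j<P eq with <-cmp i j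
    ... | tri< i<j _ _ = contradiction (i , j , i<j , j<P , eq) ¬rec
    ... | tri≈ _ i≡j _ = i≡j
    ... | tri> _ _ j<i = contradiction (j , i , j<i , i<P , sym eq) ¬rec

  period≤2^s : ∀ {P c} (T : Covering P c) → ¬ Recurrence T → P ≤ 2 ^ s
  period≤2^s {P} T ¬rec = begin
    P                ≡⟨ length-upTo P ⟨
    length (upTo P)  ≤⟨ distinctWindows⇒length-≤ T ¬rec s (upTo⁺ P) (λ i∈ → ∈-upTo⁻ i∈ , count≤n _ s) ⟩
    ballSize s s     ≤⟨ ballSize≤2^ s s ⟩
    2 ^ s            ∎
    where open ≤-Reasoning

  -- Window weights and Markov's inequality

  module _ {P c} (T : Covering P c) where
    private
      α = indicator T
      C = count α P

    weight : ℕ → ℕ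
    weight i = count (α ∘ (i +_)) s

    -- Double counting: for each of the `s` offsets `k`, the places `i + k` run through one full
    -- period.
    sum-weight : sumBelow P weight ≡ s * C
    sum-weight = begin
      sumBelow P (λ i → sumBelow s (λ k → bit (α (i + k))))
        ≡⟨ sumBelow-swap P s (λ i k → bit (α (i + k))) ⟩
      sumBelow s (λ k → sumBelow P (λ i → bit (α (i + k))))
        ≡⟨ sumBelow-cong s (λ k _ → trans
             (sumBelow-cong P λ i _ → cong (bit ∘ α) (+-comm i k))
             (sumBelow-rotate P (bit ∘ α) (cong bit ∘ periodic T) k)) ⟩
      sumBelow s (λ _ → C)
        ≡⟨ sumBelow-const s C ⟩
      s * C ∎
      where open ≡-Reasoning

    count-positive-indicator : .{{_ : NonZero P}} → 1 ≤ C
    count-positive-indicator with covers T 0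
    ... | x , _ , eq = count-positive α P ((s ∸ x) % P) (m%n<n (s ∸ x) P) (trans (periodic-% T (s ∸ x)) eq)

    -- Markov: the average weight of a window is s C / P, so at most half of them exceed twice that.
    lightWindows : 1 ≤ s → .{{_ : NonZero P}} → ∀ m → (∀ i → m < weight i → 2 * (s * C) ≤ P * weight i) →
      P ≤ 2 * count (λ i → does (weight i ≤? m)) P
    lightWindows 1≤s m heavy⇒ = +-cancelʳ-≤ P P (2 * ℓ) (begin
      P + P              ≡⟨ cong (P +_) (+-identityʳ P) ⟨
      2 * P              ≡⟨ cong (2 *_) ℓ+h≡P ⟨
      2 * (ℓ + h)        ≡⟨ *-distribˡ-+ 2 ℓ h ⟩
      2 * ℓ + 2 * h      ≤⟨ +-monoʳ-≤ (2 * ℓ) 2h≤P ⟩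
      2 * ℓ + P          ∎)
      where
      open ≤-Reasoning
      light heavy : ℕ → Bool
      light i = does (weight i ≤? m)
      heavy i = not (light i)
      ℓ = count light P
      h = count heavy P
      ℓ+h≡P : ℓ + h ≡ P
      ℓ+h≡P = trans (sym (sumBelow-+ P (bit ∘ light) (bit ∘ heavy)))
        (trans (sumBelow-cong P λ i _ → one (light i)) (trans (sumBelow-const P 1) (*-identityʳ P)))
        where
        one : ∀ b → bit b + bit (not b) ≡ 1
        one false = refl
        one true  = refl
      pointwise : ∀ i (d : Dec (weight i ≤ m)) → 2 * (s * C) * bit (not (does d)) ≤ P * weight i
      pointwise i (yes _) = ≤-trans (≤-reflexive (*-zeroʳ (2 * (s * C)))) z≤n
      pointwise i (no ≰m) = ≤-trans (≤-reflexive (*-identityʳ (2 * (s * C)))) (heavy⇒ i (≰⇒> ≰m))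
      2h≤P : 2 * h ≤ P
      -- The cancelled factor is positive because `1 ≤ s`, and because covering the integer 0 takes
      -- at least one position.
      2h≤P = *-cancelˡ-≤ (s * C) {{>-nonZero (*-mono-≤ 1≤s count-positive-indicator)}} (begin
        s * C * (2 * h)                                   ≡⟨ *-assoc (s * C) 2 h ⟨
        s * C * 2 * h                                     ≡⟨ cong (_* h) (*-comm (s * C) 2) ⟩
        2 * (s * C) * h                                   ≡⟨ sumBelow-*ˡ P (2 * (s * C)) (bit ∘ heavy) ⟨
        sumBelow P (λ i → 2 * (s * C) * bit (heavy i))    ≤⟨ sumBelow-mono P (λ i _ → pointwise i (weight i ≤? m)) ⟩
        sumBelow P (λ i → P * weight i)                   ≡⟨ sumBelow-*ˡ P P weight ⟩
        P * sumBelow P weight                             ≡⟨ cong (P *_) sum-weight ⟩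
        P * (s * C)                                       ≡⟨ *-comm P (s * C) ⟩
        s * C * P                                         ∎)

    -- The integer part of 2sτ when `T` is optimal with exact count `C`. It is capped at `s`, where
    -- the sum in `binomSumUpTo` ends.
    threshold : .{{_ : NonZero P}} → ℕ
    threshold = s ⊓ (2 * (s * C) / P)

    threshold*P≤ : .{{_ : NonZero P}} → threshold * P ≤ 2 * (s * C)
    threshold*P≤ = ≤-trans (*-monoˡ-≤ P (m⊓n≤n s _)) (m/n*n≤m (2 * (s * C)) P)

    period≤2*ballSize : 1 ≤ s → .{{_ : NonZero P}} → ¬ Recurrence T → P ≤ 2 * ballSize s threshold
    period≤2*ballSize 1≤s ¬rec = ≤-trans (lightWindows 1≤s m heavy⇒) (*-monoʳ-≤ 2 (begin
      count light P             ≡⟨ length-support light P ⟨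
      length (support light P)  ≤⟨ distinctWindows⇒length-≤ T ¬rec m (filter⁺ (λ i → light i ≟ᵇ true) (upTo⁺ P)) below ⟩
      ballSize s m              ∎))
      where
      open ≤-Reasoning
      m = threshold
      light : ℕ → Bool
      light i = does (weight i ≤? m)
      below : ∀ {i} → i ∈ support light P → i < P × weight i ≤ m
      below {i} i∈ with ∈-filter⁻ (λ i → light i ≟ᵇ true) {xs = upTo P} i∈
      ... | i∈upTo , eq = ∈-upTo⁻ i∈upTo , does⇒ (weight i ≤? m) eq
      heavy⇒ : ∀ i → m < weight i → 2 * (s * C) ≤ P * weight i
      -- If the cap `s` is attained, no window is heavy, since a weight is at most `s`. Otherwise a
      -- heavy window weighs at least one more than the integer part `q`, hence at least the
      -- fraction itself.
      heavy⇒ i m<w with ≤-total s (2 * (s * C) / P)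
      ... | inj₁ s≤q = contradiction (<-≤-trans (subst (_< weight i) (m≤n⇒m⊓n≡m s≤q) m<w) (count≤n _ s)) (<-irrefl refl)
      ... | inj₂ q≤s = begin
        2 * (s * C)                                  ≡⟨ m≡m%n+[m/n]*n (2 * (s * C)) P ⟩
        2 * (s * C) % P + q * P                      ≤⟨ +-monoˡ-≤ (q * P) (m%n≤n (2 * (s * C)) P) ⟩
        suc q * P                                    ≤⟨ *-monoˡ-≤ P (subst (_< weight i) (m≥n⇒m⊓n≡n q≤s) m<w) ⟩
        weight i * P                                 ≡⟨ *-comm (weight i) P ⟩
        P * weight i                                 ∎
        where q = 2 * (s * C) / P

  -- The best density

  BestDensity : ℕ → ℕ → Set
  BestDensity L c = ∀ P p → Covering P p → c * P ≤ p * L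

  -- Strong induction on the period. No half of a split has to be singled out: the cross-multiplied
  -- inequalities of the two halves add up to that of the whole.
  bestDensity-from-small : ∀ L c → (∀ P p → 0 < P → P ≤ 2 ^ s → Covering P p → c * P ≤ p * L) → BestDensity L c
  bestDensity-from-small L c small = <-rec _ step
    where
    step : ∀ P → (∀ {P′} → P′ < P → ∀ p → Covering P′ p → c * P′ ≤ p * L) → ∀ p → Covering P p → c * P ≤ p * L
    step zero        rec p T = ≤-trans (≤-reflexive (*-zeroʳ c)) z≤n
    step P@(suc _)   rec p T with recurrence? T
    ... | no ¬rec = small P p z<s (period≤2^s T ¬rec) T
    ... | yes (i , j , i<j , j<P , eq) = begin
      c * P              ≡⟨ cong (c *_) d+e≡P ⟨
      c * (d + e)        ≡⟨ *-distribˡ-+ c d e ⟩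
      c * d + c * e      ≤⟨ +-mono-≤ (rec (subst (d <_) d+e≡P (m<m+n d 0<e)) c₁ first)
                                     (rec (subst (e <_) d+e≡P (m<n+m e 0<d)) c₂ second) ⟩
      c₁ * L + c₂ * L    ≡⟨ *-distribʳ-+ L c₁ c₂ ⟨
      (c₁ + c₂) * L      ≤⟨ *-monoˡ-≤ L c₁+c₂≤c ⟩
      p * L              ∎
      where
      open ≤-Reasoning
      open Split (split T i j i<j j<P eq)

  -- An optimal covering of least period

  module Optimum {x₀} (x₀∈S : x₀ ∈ S) where

    minCount : ∀ P .{{_ : NonZero P}} → ∃ λ c → Covering P c × (∀ p → Covering P p → c ≤ p)
    minCount P = least (covering? P) P (fullCovering P x₀∈S)

    private
      cross-trans : ∀ a b c d e f .{{_ : NonZero d}} → a * d ≤ c * b → c * f ≤ e * d → a * f ≤ e * b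
      cross-trans a b c d e f h₁ h₂ = *-cancelʳ-≤ (a * f) (e * b) d (begin
        a * f * d    ≡⟨ swap a f d ⟩
        a * d * f    ≤⟨ *-monoˡ-≤ f h₁ ⟩
        c * b * f    ≡⟨ swap c b f ⟩
        c * f * b    ≤⟨ *-monoˡ-≤ b h₂ ⟩
        e * d * b    ≡⟨ swap e d b ⟩
        e * b * d    ∎)
        where
        open ≤-Reasoning
        swap : ∀ x y z → x * y * z ≡ x * z * y
        swap = solve-∀

      minMean : ∀ B → ∃ λ L → ∃ λ c → 0 < L × L ≤ suc B × Covering L c ×
        (∀ P p → 0 < P → P ≤ suc B → Covering P p → c * P ≤ p * L)
      minMean zero with minCount 1
      ... | c , T , min = 1 , c , z<s , ≤-refl , T , λ where
        1 p _ _ T′ → *-monoˡ-≤ 1 (min p T′)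
        (suc (suc _)) p _ (s≤s ()) T′
      minMean (suc B) with minMean B | minCount (suc (suc B))
      ... | L , c , 0<L , L≤ , T , best | c′ , T′ , min with c * suc (suc B) ≤? c′ * L
      ...   | yes h = L , c , 0<L , m≤n⇒m≤1+n L≤ , T , best′
        where
        best′ : ∀ P p → 0 < P → P ≤ suc (suc B) → Covering P p → c * P ≤ p * L
        best′ P p 0<P P≤ U with m≤n⇒m<n∨m≡n P≤
        ... | inj₁ P<   = best P p 0<P (≤-pred P<) U
        ... | inj₂ refl = ≤-trans h (*-monoˡ-≤ L (min p U))
      ...   | no ≰ = suc (suc B) , c′ , z<s , ≤-refl , T′ , best′
        where
        best′ : ∀ P p → 0 < P → P ≤ suc (suc B) → Covering P p → c′ * P ≤ p * suc (suc B)
        best′ P p 0<P P≤ U with m≤n⇒m<n∨m≡n P≤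
        ... | inj₁ P<   = cross-trans c′ (suc (suc B)) c L p P {{>-nonZero 0<L}} (<⇒≤ (≰⇒> ≰)) (best P p 0<P (≤-pred P<) U)
        ... | inj₂ refl = *-monoˡ-≤ P (min p U)

    -- `minimal` both forbids a recurrence in `T` and identifies `L` as ℓ(S). Its condition `0 < P`
    -- matters: period 0 admits a covering with count 0, for which `p * L ≤ c * P` holds trivially.
    record Optimal : Set where
      field
        L       : ℕ
        0<L     : 0 < L
        L≤2^s   : L ≤ 2 ^ s
        c       : ℕ
        T       : Covering L c
        c≡count : c ≡ count (indicator T) L
        best    : BestDensity L c
        minimal : ∀ P p → 0 < P → Covering P p → p * L ≤ c * P → L ≤ P

      instance
        nonZeroL : NonZero L
        nonZeroL = >-nonZero 0<L

      -- One half of a split optimal covering is no denser than the whole, hence again optimal.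
      ¬recurrence : ¬ Recurrence T
      ¬recurrence (i , j , i<j , j<L , eq) =
        contradiction (minimal d c₁ 0<d first c₁L≤cd) (<⇒≱ (subst (d <_) d+e≡P (m<m+n d 0<e)))
        where
        open Split (split T i j i<j j<L eq)
        open ≤-Reasoning
        c₁L≤cd : c₁ * L ≤ c * d
        c₁L≤cd = +-cancelʳ-≤ (c₂ * L) _ _ (begin
          c₁ * L + c₂ * L   ≡⟨ *-distribʳ-+ L c₁ c₂ ⟨
          (c₁ + c₂) * L     ≤⟨ *-monoˡ-≤ L c₁+c₂≤c ⟩
          c * L             ≡⟨ cong (c *_) d+e≡P ⟨
          c * (d + e)       ≡⟨ *-distribˡ-+ c d e ⟩
          c * d + c * e     ≤⟨ +-monoʳ-≤ (c * d) (best e c₂ second) ⟩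
          c * d + c₂ * L    ∎)

    -- Two searches: `minMean` over the periods up to `2 ^ s` fixes the optimal density, and `least`
    -- then finds the smallest period at which this density is reached.
    optimal : Optimal
    optimal with minMean (pred (2 ^ s))
    ... | L₀ , c₀ , 0<L₀ , L₀≤ , T₀ , small = fromLeast (least opt? L₀ (0<L₀ , c₀ , T₀ , ≤-refl))
      where
      instance
        nonZeroL₀ : NonZero L₀
        nonZeroL₀ = >-nonZero 0<L₀
      2^s≡ : suc (pred (2 ^ s)) ≡ 2 ^ s
      2^s≡ = suc-pred (2 ^ s) {{m^n≢0 2 s}}
      best₀ : BestDensity L₀ c₀
      best₀ = bestDensity-from-small L₀ c₀ λ P p 0<P P≤ → small P p 0<P (≤-trans P≤ (≤-reflexive (sym 2^s≡)))
      Opt : ℕ → Set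
      Opt P = 0 < P × ∃ λ p → Covering P p × p * L₀ ≤ c₀ * P
      opt? : ∀ P → Dec (Opt P)
      opt? zero = no λ ()
      opt? P@(suc _) with minCount P
      ... | p , U , min = map′ (λ h → z<s , p , U , h)
                               (λ (_ , p′ , U′ , h) → ≤-trans (*-monoˡ-≤ L₀ (min p′ U′)) h)
                               (p * L₀ ≤? c₀ * P)
      fromLeast : (∃ λ L → Opt L × (∀ P → Opt P → L ≤ P)) → Optimal
      fromLeast (L , (0<L , p , U , h) , min) = record
        { L = L ; 0<L = 0<L
        ; L≤2^s = ≤-trans (min L₀ (0<L₀ , c₀ , T₀ , ≤-refl)) (≤-trans L₀≤ (≤-reflexive 2^s≡))
        -- The exact count replaces the bound `p`, so that `c` and `L` give the density of the set
        -- itself.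
        ; c = count (indicator U) L
        ; T = record { Covering U ; count≤c = ≤-refl }
        ; c≡count = refl
        ; best = λ P q V → cross-trans (count (indicator U) L) L c₀ L₀ q P h′ (best₀ P q V)
        ; minimal = λ P q 0<P V q≤ → min P (0<P , q , V , cross-trans q P (count (indicator U) L) L c₀ L₀ {{>-nonZero 0<L}} q≤ h′)
        }
        where
        h′ : count (indicator U) L * L₀ ≤ c₀ * L
        h′ = ≤-trans (*-monoˡ-≤ L₀ (count≤c U)) h

-- Sparse coverings

module _ {A : Set} {Q : A → Set} (Q? : ∀ x → Dec (Q x)) where

  length-filter-¬ : ∀ xs → length (filter Q? xs) + length (filter (¬? ∘ Q?) xs) ≡ length xs
  length-filter-¬ []       = refl
  length-filter-¬ (x ∷ xs) with does (Q? x)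
  ... | true  = cong suc (length-filter-¬ xs)
  ... | false = trans (+-suc _ _) (cong suc (length-filter-¬ xs))

module SparseCovering (S : List ℕ) (s : ℕ) (unique : Unique S) (bounded : All (_≤ s) S) where

  open Coverings S s

  private
    N : ℕ
    N = suc s

  Hits : ℕ → ℕ → Set
  Hits p i = Any (λ x → (i + (s ∸ x)) % N ≡ p) S

  hits? : ∀ p i → Dec (Hits p i)
  hits? p i = any? (λ x → (i + (s ∸ x)) % N ≟ p) S

  gain : List ℕ → ℕ → ℕ
  gain U p = length (filter (hits? p) U)

  gain-∷ : ∀ i U p → gain (i ∷ U) p ≡ bit (does (hits? p i)) + gain U p
  gain-∷ i U p with does (hits? p i)
  ... | true  = refl
  ... | false = refl

  -- The modulus is `s + 1` so that the numbers `s ∸ x`, `x ∈ S`, all lie below it; hence the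
  -- positions from which `i` is covered stay distinct modulo `N`.
  length≤hitters : ∀ i → length S ≤ count (λ p → does (hits? p i)) N
  length≤hitters i = ≤-trans
    (injection⇒length-≤ pos unique
      (λ {x} x∈S → ∈-filter⁺ (λ p → does (hits? p i) ≟ᵇ true) (∈-upTo⁺ (m%n<n (i + (s ∸ x)) N))
                     (dec-true (hits? _ i) (lose x∈S refl)))
      λ {x} {y} x∈S y∈S eq → ∸-cancelˡ-≡ (All.lookup bounded x∈S) (All.lookup bounded y∈S)
        (%-cancelˡ-+ i _ _ N (s≤s (m∸n≤m s x)) (s≤s (m∸n≤m s y)) eq))
    (≤-reflexive (length-support (λ p → does (hits? p i)) N))
    where
    pos : ℕ → ℕ
    pos x = (i + (s ∸ x)) % N

  sum-gain : ∀ U → length U * length S ≤ sumBelow N (gain U)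
  sum-gain []      = z≤n
  sum-gain (i ∷ U) = begin
    length S + length U * length S
      ≤⟨ +-mono-≤ (length≤hitters i) (sum-gain U) ⟩
    count (λ p → does (hits? p i)) N + sumBelow N (gain U)
      ≡⟨ sumBelow-+ N (λ p → bit (does (hits? p i))) (gain U) ⟨
    sumBelow N (λ p → bit (does (hits? p i)) + gain U p)
      ≡⟨ sumBelow-cong N (λ p _ → sym (gain-∷ i U p)) ⟩
    sumBelow N (gain (i ∷ U)) ∎
    where open ≤-Reasoning

  -- `bound` is the accounting of the greedy procedure: every chosen position pays for at least `q`
  -- elements that it removes from the uncovered ones.
  record Greedy (q : ℕ) (U : List ℕ) : Set where
    field
      chosen left : List ℕ
      bound       : q * length chosen + length left ≤ length U
      stuck       : ∀ p → p < N → gain left p ≤ q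
      handled     : ∀ {i} → i ∈ U → i ∈ left ⊎ ∃ λ p → p ∈ chosen × Hits p i

  greedy : ∀ q → 1 ≤ q → ∀ U → Greedy q U
  greedy q 1≤q U = go (length U) U ≤-refl
    where
    go : ∀ b U → length U ≤ b → Greedy q U
    go b U U≤b with anyUpTo? (λ p → q ≤? gain U p) N
    go b U U≤b | no ¬p = record
      { chosen = [] ; left = U ; bound = ≤-reflexive (cong (_+ length U) (*-zeroʳ q))
      ; stuck = λ p p<N → <⇒≤ (≰⇒> λ q≤ → ¬p (p , p<N , q≤)) ; handled = inj₁ }
    go b U U≤b | yes (p , p<N , q≤gain) = extend b U≤b
      where
      V = filter (¬? ∘ hits? p) U
      V+q≤U : q + length V ≤ length U
      V+q≤U = ≤-trans (+-monoˡ-≤ (length V) q≤gain) (≤-reflexive (length-filter-¬ (hits? p) U))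
      extend : ∀ b → length U ≤ b → Greedy q U
      extend zero    U≤b = contradiction (≤-trans (m≤m+n q (length V)) (≤-trans V+q≤U U≤b)) (<⇒≱ 1≤q)
      extend (suc b) U≤b = record
        { chosen = p ∷ chosen ; left = left
        ; bound = begin
            q * suc (length chosen) + length left    ≡⟨ cong (_+ length left) (*-suc q (length chosen)) ⟩
            q + q * length chosen + length left      ≡⟨ +-assoc q _ _ ⟩
            q + (q * length chosen + length left)    ≤⟨ +-monoʳ-≤ q bound ⟩
            q + length V                             ≤⟨ V+q≤U ⟩
            length U                                 ∎
        ; stuck = stuck ; handled = handled′ }
        where
        open ≤-Reasoning
        open Greedy (go b V (≤-pred (≤-trans (+-monoˡ-≤ (length V) 1≤q) (≤-trans V+q≤U U≤b))))
        handled′ : ∀ {i} → i ∈ U → i ∈ left ⊎ ∃ λ r → r ∈ p ∷ chosen × Hits r i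
        handled′ {i} i∈U with hits? p i
        ... | yes h = inj₂ (p , here refl , h)
        ... | no ¬h with handled (∈-filter⁺ (¬? ∘ hits? p) i∈U ¬h)
        ...   | inj₁ i∈left         = inj₁ i∈left
        ...   | inj₂ (r , r∈ , h) = inj₂ (r , there r∈ , h)

  -- Greedily add translates that cover at least q new residues; when none is left,
  -- double counting shows that at most q N / |S| residues are uncovered.
  sparseCovering : ∀ {x₀} → x₀ ∈ S → ∀ q → 1 ≤ q → q * q ≤ length S →
    ∃ λ c → Covering N c × q * c ≤ 2 * N
  sparseCovering {x₀} x₀∈S q 1≤q q²≤k = length R , fromPositions N R cov , qR≤2N
    where
    open Greedy (greedy q 1≤q (upTo N))
    open ≤-Reasoning
    pos : ℕ → ℕ
    pos i = (i + (s ∸ x₀)) % N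
    -- Each residue left over by the greedy choice receives a translate of its own, covering it
    -- through `x₀`.
    R = chosen ++ map pos left
    cov : ∀ {i} → i < N → Any (λ x → (i + (s ∸ x)) % N ∈ R) S
    cov i<N with handled (∈-upTo⁺ i<N)
    ... | inj₁ i∈left         = lose x₀∈S (∈-++⁺ʳ chosen (∈-map⁺ pos i∈left))
    ... | inj₂ (p , p∈ , hit) = Any.map (λ { refl → ∈-++⁺ˡ p∈ }) hit
    q*chosen≤N : q * length chosen ≤ N
    q*chosen≤N = ≤-trans (m≤m+n _ _) (≤-trans bound (≤-reflexive (length-upTo N)))
    q*left≤N : q * length left ≤ N
    q*left≤N = *-cancelʳ-≤ _ N q {{>-nonZero 1≤q}} (begin
      q * length left * q      ≡⟨ rearrange q (length left) ⟩
      length left * (q * q)    ≤⟨ *-monoʳ-≤ (length left) q²≤k ⟩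
      length left * length S   ≤⟨ sum-gain left ⟩
      sumBelow N (gain left)   ≤⟨ sumBelow-mono N (λ p → stuck p) ⟩
      sumBelow N (λ _ → q)     ≡⟨ sumBelow-const N q ⟩
      N * q                    ∎)
      where
      rearrange : ∀ a b → a * b * a ≡ b * (a * a)
      rearrange = solve-∀
    qR≤2N : q * length R ≤ 2 * N
    qR≤2N = begin
      q * length R                             ≡⟨ cong (q *_) (trans (length-++ chosen)
                                                    (cong (length chosen +_) (length-map pos left))) ⟩
      q * (length chosen + length left)        ≡⟨ *-distribˡ-+ q (length chosen) (length left) ⟩
      q * length chosen + q * length left      ≤⟨ +-mono-≤ q*chosen≤N q*left≤N ⟩
      N + N                                    ≡⟨ cong (N +_) (+-identityʳ N) ⟨
      2 * N                                    ∎

-- Growth estimates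

2j≤2^j : ∀ j → 1 ≤ j → 2 * j ≤ 2 ^ j
2j≤2^j (suc zero)    _ = ≤-refl
2j≤2^j (suc (suc j)) _ = begin
  2 * suc (suc j)             ≡⟨ *-suc 2 (suc j) ⟩
  2 + 2 * suc j               ≤⟨ +-mono-≤ (*-monoʳ-≤ 2 (m^n>0 2 j)) (2j≤2^j (suc j) (s≤s z≤n)) ⟩
  2 ^ suc j + 2 ^ suc j       ≡⟨ cong (2 ^ suc j +_) (+-identityʳ (2 ^ suc j)) ⟨
  2 ^ suc (suc j)             ∎
  where open ≤-Reasoning

-- After division by `M ^ j` this is (1 + 1/M)^j ≤ 1 + 2j/M ≤ 2, a converse of Bernoulli's
-- inequality. The induction works as long as 2i ≤ M, because the cross term 2i/M² is then at most
-- 1/M.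
[1+M]^j≤2*M^j : ∀ M .{{_ : NonZero M}} j → 2 * j ≤ M → suc M ^ j ≤ 2 * M ^ j
[1+M]^j≤2*M^j M j 2j≤M = *-cancelˡ-≤ M (begin
  M * suc M ^ j          ≤⟨ bernoulli j 2j≤M ⟩
  M ^ j * (M + 2 * j)    ≤⟨ *-monoʳ-≤ (M ^ j) (+-monoʳ-≤ M 2j≤M) ⟩
  M ^ j * (M + M)        ≡⟨ rearrange (M ^ j) M ⟩
  M * (2 * M ^ j)        ∎)
  where
  open ≤-Reasoning
  rearrange : ∀ a b → a * (b + b) ≡ b * (2 * a)
  rearrange = solve-∀
  expand : ∀ a b i → a * (b + 2 * i) * (1 + b) ≡ a * (b * b + 2 * i * b + b + 2 * i)
  expand = solve-∀
  collect : ∀ a b i → a * (b * b + 2 * i * b + b + b) ≡ b * a * (b + 2 * (1 + i))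
  collect = solve-∀
  regroup : ∀ a b c → a * (b * c) ≡ (a * c) * b
  regroup = solve-∀
  bernoulli : ∀ i → 2 * i ≤ M → M * suc M ^ i ≤ M ^ i * (M + 2 * i)
  bernoulli zero    _    = ≤-reflexive (trans (*-identityʳ M) (sym (trans (*-identityˡ (M + 0)) (+-identityʳ M))))
  bernoulli (suc i) 2i≤M = begin
    M * (suc M * suc M ^ i)                       ≡⟨ regroup M (suc M) (suc M ^ i) ⟩
    M * suc M ^ i * suc M                         ≤⟨ *-monoˡ-≤ (suc M) (bernoulli i 2i≤M′) ⟩
    M ^ i * (M + 2 * i) * suc M                   ≡⟨ expand (M ^ i) M i ⟩
    M ^ i * (M * M + 2 * i * M + M + 2 * i)       ≤⟨ *-monoʳ-≤ (M ^ i) (+-monoʳ-≤ (M * M + 2 * i * M + M) 2i≤M′) ⟩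
    M ^ i * (M * M + 2 * i * M + M + M)           ≡⟨ collect (M ^ i) M i ⟩
    M * M ^ i * (M + 2 * suc i)                   ∎
    where
    2i≤M′ : 2 * i ≤ M
    2i≤M′ = ≤-trans (*-monoʳ-≤ 2 (n≤1+n i)) 2i≤M

^-distribʳ-* : ∀ a b n → (a * b) ^ n ≡ a ^ n * b ^ n
^-distribʳ-* a b zero    = refl
^-distribʳ-* a b (suc n) = trans (cong (a * b *_) (^-distribʳ-* a b n)) (rearrange a b (a ^ n) (b ^ n))
  where
  rearrange : ∀ a b c d → a * b * (c * d) ≡ a * c * (b * d)
  rearrange = solve-∀

-- ballSize-chernoff with M = 2 ^ j, for which (1 + 1/M)^j ≤ 2.
ballSize^j≤ : ∀ s m j → 1 ≤ j → j * j * m ≤ 4 * s → ballSize s m ^ j ≤ 2 ^ (5 * s)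
ballSize^j≤ s m j 1≤j j²m≤4s = *-cancelʳ-≤ _ _ (M ^ (s * j)) {{m^n≢0 M (s * j)}} (begin
  ballSize s m ^ j * M ^ (s * j)        ≡⟨ cong (ballSize s m ^ j *_) (^-*-assoc M s j) ⟨
  ballSize s m ^ j * (M ^ s) ^ j        ≡⟨ ^-distribʳ-* (ballSize s m) (M ^ s) j ⟨
  (ballSize s m * M ^ s) ^ j            ≤⟨ ^-monoˡ-≤ j (ballSize-chernoff M s m) ⟩
  (suc M ^ s * M ^ m) ^ j               ≡⟨ ^-distribʳ-* (suc M ^ s) (M ^ m) j ⟩
  (suc M ^ s) ^ j * (M ^ m) ^ j         ≤⟨ *-mono-≤ left right ⟩
  2 ^ s * M ^ (s * j) * 2 ^ (4 * s)     ≡⟨ swap (2 ^ s) (M ^ (s * j)) (2 ^ (4 * s)) ⟩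
  2 ^ s * 2 ^ (4 * s) * M ^ (s * j)     ≡⟨ cong (_* M ^ (s * j)) (^-distribˡ-+-* 2 s (4 * s)) ⟨
  2 ^ (5 * s) * M ^ (s * j)             ∎)
  where
  open ≤-Reasoning
  -- Large enough for `2 * j ≤ M`, so that (1 + 1/M)^(sj) costs at most `2 ^ s`; small enough that
  -- `M ^ (m * j)`, a power of 2 with exponent `j * j * m`, costs at most `2 ^ (4 * s)`. Hence the
  -- 5.
  M = 2 ^ j
  instance
    nonZeroM : NonZero M
    nonZeroM = m^n≢0 2 j
  swap : ∀ a b c → a * b * c ≡ a * c * b
  swap = solve-∀
  exponent : ∀ j m → j * (m * j) ≡ j * j * m
  exponent = solve-∀
  left : (suc M ^ s) ^ j ≤ 2 ^ s * M ^ (s * j)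
  left = begin
    (suc M ^ s) ^ j        ≡⟨ ^-*-assoc (suc M) s j ⟩
    suc M ^ (s * j)        ≡⟨ cong (suc M ^_) (*-comm s j) ⟩
    suc M ^ (j * s)        ≡⟨ ^-*-assoc (suc M) j s ⟨
    (suc M ^ j) ^ s        ≤⟨ ^-monoˡ-≤ s ([1+M]^j≤2*M^j M j (2j≤2^j j 1≤j)) ⟩
    (2 * M ^ j) ^ s        ≡⟨ ^-distribʳ-* 2 (M ^ j) s ⟩
    2 ^ s * (M ^ j) ^ s    ≡⟨ cong (2 ^ s *_) (^-*-assoc M j s) ⟩
    2 ^ s * M ^ (j * s)    ≡⟨ cong (λ n → 2 ^ s * M ^ n) (*-comm j s) ⟩
    2 ^ s * M ^ (s * j)    ∎
  right : (M ^ m) ^ j ≤ 2 ^ (4 * s)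
  right = begin
    (M ^ m) ^ j            ≡⟨ ^-*-assoc M m j ⟩
    M ^ (m * j)            ≡⟨ ^-*-assoc 2 j (m * j) ⟩
    2 ^ (j * (m * j))      ≡⟨ cong (2 ^_) (exponent j m) ⟩
    2 ^ (j * j * m)        ≤⟨ ^-monoʳ-≤ 2 j²m≤4s ⟩
    2 ^ (4 * s)            ∎

-- The integer part of the fourth root, except that the value at 0 is 1: it serves as a denominator
-- and must be positive.
root4 : ℕ → ℕ
root4 zero    = 1
root4 (suc k) with suc (root4 k) ^ 4 ≤? suc k
... | yes _ = suc (root4 k)
... | no  _ = root4 k

root4-positive : ∀ k → 1 ≤ root4 k
root4-positive zero    = ≤-refl
root4-positive (suc k) with suc (root4 k) ^ 4 ≤? suc k
... | yes _ = s≤s z≤n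
... | no  _ = root4-positive k

root4-lower : ∀ k → root4 (suc k) ^ 4 ≤ suc k
root4-lower k with suc (root4 k) ^ 4 ≤? suc k
root4-lower k       | yes h = h
root4-lower zero    | no _  = ≤-refl
root4-lower (suc k) | no _  = m≤n⇒m≤1+n (root4-lower k)

root4-upper : ∀ k → k < suc (root4 k) ^ 4
root4-upper zero    = s≤s z≤n
root4-upper (suc k) with suc (root4 k) ^ 4 ≤? suc k
... | yes _ = <-≤-trans (s<s (root4-upper k)) (^-monoˡ-< 4 (n<1+n (suc (root4 k))))
... | no ≰  = ≰⇒> ≰

-- Fractions and residues

open import Data.Integer as ℤ using (ℤ; +_; _%ℕ_; _/ℕ_; +≤+)
import Data.Integer.Properties as ℤ
open import Data.Integer.DivMod using (n%ℕd<d; a≡a%ℕn+[a/ℕn]*n)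
import Data.Integer.Tactic.RingSolver as ℤSolver
open import Data.Rational as ℚ using (ℚ; 0ℚ; ½; mkℚ; toℚᵘ; positive)
import Data.Rational.Properties as ℚ
open import Data.Rational.Solver using (module +-*-Solver)
open import Data.Rational.Unnormalised as ℚᵘ using (mkℚᵘ; *≤*; *≡*)
import Data.Rational.Unnormalised.Properties as ℚᵘ
open import Algebra.Properties.AbelianGroup ℚ.+-0-abelianGroup using (x∙y⁻¹≈ε⇒x≈y; xyx⁻¹≈y; ⁻¹-anti-homo‿-)
open import Algebra.Properties.AbelianGroup ℤ.+-0-abelianGroup using () renaming (∙-cancelʳ to ℤ-+-cancelʳ)

fraction : ℕ → ∀ n .{{_ : NonZero n}} → ℚ
fraction a n = + a ℚ./ n

fraction-≤ : ∀ a b c d .{{_ : NonZero b}} .{{_ : NonZero d}} → a * d ≤ c * b → fraction a b ℚ.≤ fraction c d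
fraction-≤ a (suc b) c (suc d) h = ℚ.toℚᵘ-cancel-≤
  (ℚᵘ.≤-respˡ-≃ (ℚᵘ.≃-sym (ℚ.toℚᵘ-fromℚᵘ (mkℚᵘ (+ a) b)))
    (ℚᵘ.≤-respʳ-≃ (ℚᵘ.≃-sym (ℚ.toℚᵘ-fromℚᵘ (mkℚᵘ (+ c) d)))
      (*≤* (subst₂ ℤ._≤_ (ℤ.pos-* a (suc d)) (ℤ.pos-* c (suc b)) (+≤+ h)))))

fraction-injective : ∀ a b c d .{{_ : NonZero b}} .{{_ : NonZero d}} →
  fraction a b ≡ fraction c d → a * d ≡ c * b
fraction-injective a (suc b) c (suc d) eq with ℚ./-injective-≃ (mkℚᵘ (+ a) b) (mkℚᵘ (+ c) d) eq
... | *≡* h = ℤ.+-injective (trans (ℤ.pos-* a (suc d)) (trans h (sym (ℤ.pos-* c (suc b)))))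

fraction-+ : ∀ a b c d .{{_ : NonZero b}} .{{_ : NonZero d}} .{{_ : NonZero (b * d)}} →
  fraction a b ℚ.+ fraction c d ≡ fraction (a * d + c * b) (b * d)
fraction-+ a (suc b) c (suc d) = ℚ.toℚᵘ-injective (begin
  toℚᵘ (fraction a (suc b) ℚ.+ fraction c (suc d))
    ≈⟨ ℚ.toℚᵘ-homo-+ (fraction a (suc b)) (fraction c (suc d)) ⟩
  toℚᵘ (fraction a (suc b)) ℚᵘ.+ toℚᵘ (fraction c (suc d))
    ≈⟨ ℚᵘ.+-cong (ℚ.toℚᵘ-fromℚᵘ (mkℚᵘ (+ a) b)) (ℚ.toℚᵘ-fromℚᵘ (mkℚᵘ (+ c) d)) ⟩
  mkℚᵘ (+ a) b ℚᵘ.+ mkℚᵘ (+ c) d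
    ≈⟨ *≡* (cong (ℤ._* + (suc b * suc d)) numerator) ⟩
  mkℚᵘ (+ (a * suc d + c * suc b)) (d + b * suc d)
    ≈⟨ ℚ.toℚᵘ-fromℚᵘ (mkℚᵘ (+ (a * suc d + c * suc b)) (d + b * suc d)) ⟨
  toℚᵘ (fraction (a * suc d + c * suc b) (suc b * suc d)) ∎)
  where
  open ℚᵘ.≃-Reasoning
  numerator : + a ℤ.* + suc d ℤ.+ + c ℤ.* + suc b ≡ + (a * suc d + c * suc b)
  numerator = cong₂ ℤ._+_ (sym (ℤ.pos-* a (suc d))) (sym (ℤ.pos-* c (suc b)))

fraction-* : ∀ a c d .{{_ : NonZero d}} → fraction a 1 ℚ.* fraction c d ≡ fraction (a * c) d
fraction-* a c (suc d) = ℚ.toℚᵘ-injective (begin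
  toℚᵘ (fraction a 1 ℚ.* fraction c (suc d))
    ≈⟨ ℚ.toℚᵘ-homo-* (fraction a 1) (fraction c (suc d)) ⟩
  toℚᵘ (fraction a 1) ℚᵘ.* toℚᵘ (fraction c (suc d))
    ≈⟨ ℚᵘ.*-cong (ℚ.toℚᵘ-fromℚᵘ (mkℚᵘ (+ a) 0)) (ℚ.toℚᵘ-fromℚᵘ (mkℚᵘ (+ c) d)) ⟩
  mkℚᵘ (+ a) 0 ℚᵘ.* mkℚᵘ (+ c) d
    ≈⟨ *≡* (cong₂ ℤ._*_ (sym (ℤ.pos-* a c)) (cong (+_ ∘ suc) (sym (+-identityʳ d)))) ⟩
  mkℚᵘ (+ (a * c)) d
    ≈⟨ ℚ.toℚᵘ-fromℚᵘ (mkℚᵘ (+ (a * c)) d) ⟨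
  toℚᵘ (fraction (a * c) (suc d)) ∎)
  where open ℚᵘ.≃-Reasoning

reciprocal-below : ∀ ε → 0ℚ ℚ.< ε → ∃ λ q → Σ (NonZero q) λ nz → fraction 1 q {{nz}} ℚ.≤ ε
reciprocal-below ε 0<ε with positive 0<ε
reciprocal-below (mkℚ (+ suc a) d _) 0<ε | _ = suc d , _ , ℚ.toℚᵘ-cancel-≤
  (ℚᵘ.≤-respˡ-≃ (ℚᵘ.≃-sym (ℚ.toℚᵘ-fromℚᵘ (mkℚᵘ (+ 1) d)))
    (*≤* (+≤+ (*-monoˡ-≤ (suc d) (s≤s (z≤n {a}))))))

p-q≤ε : ∀ p q ε → p ℚ.≤ q ℚ.+ ε → p ℚ.- q ℚ.≤ ε
p-q≤ε p q ε h = subst (p ℚ.- q ℚ.≤_) (xyx⁻¹≈y q ε) (ℚ.+-monoˡ-≤ (ℚ.- q) h)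

∣p-q∣≤ε : ∀ p q ε → p ℚ.≤ q ℚ.+ ε → q ℚ.≤ p ℚ.+ ε → ℚ.∣ p ℚ.- q ∣ ℚ.≤ ε
∣p-q∣≤ε p q ε h₁ h₂ with ℚ.∣p∣≡p∨∣p∣≡-p (p ℚ.- q)
... | inj₁ eq = subst (ℚ._≤ ε) (sym eq) (p-q≤ε p q ε h₁)
... | inj₂ eq = subst (ℚ._≤ ε) (sym (trans eq (⁻¹-anti-homo‿- p q))) (p-q≤ε q p ε h₂)

-- The fractions differ by at most K/(nL). With `K` fixed this tends to 0, which turns estimates in
-- ℕ into a limit.
fraction-close : ∀ m n c L K q .{{_ : NonZero n}} .{{_ : NonZero L}} .{{_ : NonZero q}} →
  m * L ≤ c * n + K → c * n ≤ m * L + K → K * q ≤ n →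
  ℚ.∣ fraction m n ℚ.- fraction c L ∣ ℚ.≤ fraction 1 q
fraction-close m n c L K q h₁ h₂ Kq≤n = ∣p-q∣≤ε _ _ _
  (one-side m n c L h₁ (≤-trans Kq≤n (m≤m*n n L)))
  (one-side c L m n h₂ (≤-trans Kq≤n (≤-trans (m≤m*n n L) (≤-reflexive (*-comm n L)))))
  where
  one-side : ∀ a b c d .{{_ : NonZero b}} .{{_ : NonZero d}} → a * d ≤ c * b + K → K * q ≤ b * d →
    fraction a b ℚ.≤ fraction c d ℚ.+ fraction 1 q
  one-side a b c d h Kq≤bd = subst (fraction a b ℚ.≤_) (sym (fraction-+ c d 1 q))
    (fraction-≤ a b (c * q + 1 * d) (d * q) (begin
      a * (d * q)              ≡⟨ *-assoc a d q ⟨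
      a * d * q                ≤⟨ *-monoˡ-≤ q h ⟩
      (c * b + K) * q          ≡⟨ *-distribʳ-+ q (c * b) K ⟩
      c * b * q + K * q        ≤⟨ +-monoʳ-≤ (c * b * q) Kq≤bd ⟩
      c * b * q + b * d        ≡⟨ rearrange b c d q ⟩
      (c * q + 1 * d) * b      ∎))
    where
    open ≤-Reasoning
    instance
      nonZero-dq : NonZero (d * q)
      nonZero-dq = m*n≢0 d q
    rearrange : ∀ b c d q → c * b * q + b * d ≡ (c * q + 1 * d) * b
    rearrange = solve-∀

-- (k - k′)L = r′ - r is smaller than `L` in absolute value, which forces k = k′.
residue-unique : ∀ L .{{_ : NonZero L}} r r′ k k′ → r < L → r′ < L →
  + r ℤ.+ k ℤ.* + L ≡ + r′ ℤ.+ k′ ℤ.* + L → r ≡ r′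
residue-unique L r r′ k k′ r<L r′<L eq = ℤ.+-injective (ℤ-+-cancelʳ (k ℤ.* + L) (+ r) (+ r′)
  (trans eq (cong (λ j → + r′ ℤ.+ j ℤ.* + L) (sym k≡k′))))
  where
  open ≤-Reasoning
  isolate : ∀ r r′ k k′ l → r′ ℤ.+ k′ ℤ.* l ≡ r ℤ.+ k ℤ.* l → (k ℤ.- k′) ℤ.* l ≡ r′ ℤ.- r
  isolate r r′ k k′ l eq = trans (expand r k k′ l) (trans (cong (λ z → z ℤ.- r ℤ.- k′ ℤ.* l) (sym eq)) (collapse r r′ k′ l))
    where
    expand : ∀ r k k′ l → (k ℤ.- k′) ℤ.* l ≡ r ℤ.+ k ℤ.* l ℤ.- r ℤ.- k′ ℤ.* l
    expand = ℤSolver.solve-∀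
    collapse : ∀ r r′ k′ l → r′ ℤ.+ k′ ℤ.* l ℤ.- r ℤ.- k′ ℤ.* l ≡ r′ ℤ.- r
    collapse = ℤSolver.solve-∀
  ∣k-k′∣*L<L : ℤ.∣ k ℤ.- k′ ∣ * L < 1 * L
  ∣k-k′∣*L<L = begin-strict
    ℤ.∣ k ℤ.- k′ ∣ * L            ≡⟨ ℤ.abs-* (k ℤ.- k′) (+ L) ⟨
    ℤ.∣ (k ℤ.- k′) ℤ.* + L ∣      ≡⟨ cong ℤ.∣_∣ (isolate (+ r) (+ r′) k k′ (+ L) (sym eq)) ⟩
    ℤ.∣ + r′ ℤ.- + r ∣            ≡⟨ cong ℤ.∣_∣ (ℤ.m-n≡m⊖n r′ r) ⟩
    ℤ.∣ r′ ℤ.⊖ r ∣                ≤⟨ ℤ.∣m⊝n∣≤m⊔n r′ r ⟩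
    r′ ⊔ r                        <⟨ ⊔-pres-<m r′<L r<L ⟩
    L                             ≡⟨ *-identityˡ L ⟨
    1 * L                         ∎
  k≡k′ : k ≡ k′
  k≡k′ = ℤ.i-j≡0⇒i≡j k k′ (ℤ.∣i∣≡0⇒i≡0 (n<1⇒n≡0 (*-cancelʳ-< L _ 1 ∣k-k′∣*L<L)))

[n+kL]%ℕL : ∀ n k L .{{_ : NonZero L}} → (+ n ℤ.+ k ℤ.* + L) %ℕ L ≡ n % L
[n+kL]%ℕL n k L = residue-unique L (z %ℕ L) (n % L) (z /ℕ L) (+ (n / L) ℤ.+ k) (n%ℕd<d z L) (m%n<n n L) (begin
  + (z %ℕ L) ℤ.+ (z /ℕ L) ℤ.* + L                     ≡⟨ a≡a%ℕn+[a/ℕn]*n z L ⟨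
  + n ℤ.+ k ℤ.* + L                                   ≡⟨ cong (λ m → + m ℤ.+ k ℤ.* + L) (m≡m%n+[m/n]*n n L) ⟩
  + (n % L) ℤ.+ + (n / L * L) ℤ.+ k ℤ.* + L           ≡⟨ cong (λ m → + (n % L) ℤ.+ m ℤ.+ k ℤ.* + L) (ℤ.pos-* (n / L) L) ⟩
  + (n % L) ℤ.+ + (n / L) ℤ.* + L ℤ.+ k ℤ.* + L       ≡⟨ collect (+ (n % L)) (+ (n / L)) k (+ L) ⟩
  + (n % L) ℤ.+ (+ (n / L) ℤ.+ k) ℤ.* + L             ∎)
  where
  open ≡-Reasoning
  z = + n ℤ.+ k ℤ.* + L
  collect : ∀ a b c d → a ℤ.+ b ℤ.* d ℤ.+ c ℤ.* d ≡ a ℤ.+ (b ℤ.+ c) ℤ.* d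
  collect = ℤSolver.solve-∀

-- The binomial sum of the statement

LightWeight : ℕ → ℚ → ℕ → Set
LightWeight s r t = fraction t 1 ℚ.≤ fraction (2 * s) 1 ℚ.* r

lightWeight? : ∀ s r t → Dec (LightWeight s r t)
lightWeight? s r t = fraction t 1 ℚ.≤? fraction (2 * s) 1 ℚ.* r

-- The recursion inside binomSumUpTo is local and cannot be named; partialSum s r t is that
-- recursion at t, recovered by unification from binomSumUpTo (suc s) r in the case where its
-- leading term vanishes.
mutual
  private
    tailSum : ℕ → ℚ → ℕ
    tailSum = _

    tailSum-spec : ∀ s r → ¬ LightWeight (suc s) r (suc s) → binomSumUpTo (suc s) r ≡ tailSum s r
    tailSum-spec s r ¬h with lightWeight? (suc s) r (suc s)
    ... | yes h = contradiction h ¬h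
    ... | no _  = refl

  partialSum : ℕ → ℚ → ℕ → ℕ
  partialSum = _

  private
    partialSum-spec : ∀ s r → tailSum s r ≡ partialSum (suc s) r s
    -- Abstracting `suc s` makes it a variable independent of the index `s`, so that the equation
    -- determines `partialSum` at all arguments.
    partialSum-spec s r with suc s
    ... | _ = refl

partialSum-zero : ∀ s r → LightWeight s r 0 → partialSum s r 0 ≡ s C 0
partialSum-zero s r h with lightWeight? s r 0
... | yes _ = refl
... | no ¬h = contradiction h ¬h

partialSum-suc : ∀ s r t → LightWeight s r (suc t) → partialSum s r (suc t) ≡ s C suc t + partialSum s r t
partialSum-suc s r t h with lightWeight? s r (suc t)
... | yes _ = refl
... | no ¬h = contradiction h ¬h

partialSum-mono : ∀ s r {m n} → m ≤ n → partialSum s r m ≤ partialSum s r n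
partialSum-mono s r m≤n = go (≤⇒≤′ m≤n)
  where
  go : ∀ {m n} → m ≤′ n → partialSum s r m ≤ partialSum s r n
  go ≤′-refl       = ≤-refl
  go (≤′-step m≤n) = ≤-trans (go m≤n) (m≤n+m _ _)

-- The density τ(S)

-- `IsTau` constrains only those `m` that are minima, so uniqueness needs a minimum at some `n`
-- beyond both thresholds. Its doubly negated existence is enough, because equality of rationals is
-- decidable and hence stable.
IsTau-unique : ∀ S r r′ → (∀ n → ¬ ¬ ∃ (IsTauN S n)) → IsTau S r → IsTau S r′ → r ≡ r′
IsTau-unique S r r′ attained h h′ = decidable-stable (r ℚ.≟ r′) λ r≢r′ →
  let δ = ℚ.∣ r ℚ.- r′ ∣
      0≢δ : 0ℚ ≢ δ
      0≢δ 0≡δ = r≢r′ (x∙y⁻¹≈ε⇒x≈y r r′ (ℚ.∣p∣≡0⇒p≡0 (r ℚ.- r′) (sym 0≡δ)))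
      0<δ : 0ℚ ℚ.< δ
      0<δ = ℚ.≰⇒> λ δ≤0 → 0≢δ (ℚ.≤-antisym (ℚ.0≤∣p∣ (r ℚ.- r′)) δ≤0)
      halve : ∀ {x} → 0ℚ ℚ.< x → 0ℚ ℚ.< x ℚ.* ½
      halve {x} 0<x = subst (ℚ._< x ℚ.* ½) (ℚ.*-zeroˡ ½) (ℚ.*-monoˡ-<-pos ½ 0<x)
      -- With a quarter of the distance, the two errors add up to δ/2 < δ.
      ε = δ ℚ.* ½ ℚ.* ½
      0<ε = halve (halve 0<δ)
      N , hN = h ε 0<ε
      N′ , hN′ = h′ ε 0<ε
      n = suc (N + N′)
  in attained n λ (m , τₙ) →
    let x = fraction m n
        close = hN n (m≤n⇒m≤1+n (m≤m+n N N′)) _ m τₙ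
        close′ = hN′ n (m≤n⇒m≤1+n (m≤n+m N′ N)) _ m τₙ
        δ≤δ/2 : δ ℚ.≤ δ ℚ.* ½
        δ≤δ/2 = begin
          ℚ.∣ r ℚ.- r′ ∣                         ≡⟨ cong ℚ.∣_∣ (telescope r x r′) ⟩
          ℚ.∣ (x ℚ.- r′) ℚ.- (x ℚ.- r) ∣         ≤⟨ ℚ.∣p-q∣≤∣p∣+∣q∣ (x ℚ.- r′) (x ℚ.- r) ⟩
          ℚ.∣ x ℚ.- r′ ∣ ℚ.+ ℚ.∣ x ℚ.- r ∣       ≤⟨ ℚ.+-mono-≤ close′ close ⟩
          ε ℚ.+ ε                                ≡⟨ double (δ ℚ.* ½) ⟩
          δ ℚ.* ½                                ∎
        δ/2<δ : δ ℚ.* ½ ℚ.< δ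
        δ/2<δ = subst (δ ℚ.* ½ ℚ.<_) (double δ)
          (subst (ℚ._< δ ℚ.* ½ ℚ.+ δ ℚ.* ½) (ℚ.+-identityʳ (δ ℚ.* ½)) (ℚ.+-monoʳ-< (δ ℚ.* ½) (halve 0<δ)))
    in ℚ.<-irrefl refl (ℚ.<-≤-trans δ/2<δ δ≤δ/2)
  where
  open ℚ.≤-Reasoning
  double : ∀ x → x ℚ.* ½ ℚ.+ x ℚ.* ½ ≡ x
  double x = trans (sym (ℚ.*-distribˡ-+ x ½ ½)) (ℚ.*-identityʳ x)
  telescope : ∀ r x r′ → r ℚ.- r′ ≡ (x ℚ.- r′) ℚ.- (x ℚ.- r)
  telescope = +-*-Solver.solve 3 (λ r x r′ → r :- r′ := (x :- r′) :- (x :- r)) refl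
    where open +-*-Solver


module Density (S : List ℕ) (s : ℕ) (bounded : All (_≤ s) S) {x₀} (x₀∈S : x₀ ∈ S)
  (opt : Coverings.Optimum.Optimal S s x₀∈S) where

  open Coverings S s

  private
    toPosition : ∀ t x i → x ≤ s → t ℤ.+ + x ≡ + i → t ℤ.+ + s ≡ + (i + (s ∸ x))
    toPosition t x i x≤s eq = begin
      t ℤ.+ + s                      ≡⟨ cong (λ n → t ℤ.+ + n) (m+[n∸m]≡n x≤s) ⟨
      t ℤ.+ (+ x ℤ.+ + (s ∸ x))      ≡⟨ ℤ.+-assoc t (+ x) (+ (s ∸ x)) ⟨
      t ℤ.+ + x ℤ.+ + (s ∸ x)        ≡⟨ cong (ℤ._+ + (s ∸ x)) eq ⟩
      + (i + (s ∸ x))                ∎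
      where open ≡-Reasoning

    fromPosition : ∀ x i → x ≤ s → + (i + (s ∸ x)) ℤ.- + s ℤ.+ + x ≡ + i
    fromPosition x i x≤s = begin
      + i ℤ.+ + (s ∸ x) ℤ.- + s ℤ.+ + x             ≡⟨ rearrange (+ i) (+ (s ∸ x)) (+ s) (+ x) ⟩
      + i ℤ.+ (+ (s ∸ x + x) ℤ.- + s)               ≡⟨ cong (λ n → + i ℤ.+ (+ n ℤ.- + s)) (m∸n+n≡m x≤s) ⟩
      + i ℤ.+ (+ s ℤ.- + s)                         ≡⟨ cong (λ z → + i ℤ.+ z) (ℤ.+-inverseʳ (+ s)) ⟩
      + i ℤ.+ + 0                                   ≡⟨ ℤ.+-identityʳ (+ i) ⟩
      + i                                           ∎
      where
      open ≡-Reasoning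
      rearrange : ∀ a b c d → a ℤ.+ b ℤ.- c ℤ.+ d ≡ a ℤ.+ (b ℤ.+ d ℤ.- c)
      rearrange = ℤSolver.solve-∀

  -- A covering of {1,…,n} becomes a periodic one by adding the 2s + 1 positions next to the seam.
  finite⇒periodic : ∀ n T → CoversUpTo S n T → Covering (suc n + s) (suc s + (s + length T))
  finite⇒periodic n T cov = weaken (≤-reflexive length-R) (fromPositions P R hit)
    where
    -- With this period the positions used for the integers 1,...,n do not wrap around. The other
    -- residues are covered through `x₀`, from a position in `A₂` or, near 0 and after wrapping, in
    -- `A₁`.
    P = suc n + s
    A₁ = upTo (suc s)
    shiftUp : ℕ → ℕ
    shiftUp j = suc n + j
    A₂ = map shiftUp (upTo s)
    -- `t + s` is non-negative for every `t` that covers one of 1,...,n; for the others the absolute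
    -- value only adds a harmless position.
    A₃ = map (λ t → ℤ.∣ t ℤ.+ + s ∣) T
    R = A₁ ++ A₂ ++ A₃
    length-R : length R ≡ suc s + (s + length T)
    length-R = trans (length-++ A₁) (cong₂ _+_ (length-upTo (suc s)) (trans (length-++ A₂)
      (cong₂ _+_ (trans (length-map shiftUp (upTo s)) (length-upTo s)) (length-map _ T))))
    y₀ = s ∸ x₀
    y₀≤s : y₀ ≤ s
    y₀≤s = m∸n≤m s x₀
    s<P : s < P
    s<P = s≤s (m≤n+m s n)
    low : ∀ {p} → p ≤ s → p % P ∈ R
    low p≤s = ∈-++⁺ˡ (subst (_∈ A₁) (sym (m<n⇒m%n≡m (≤-<-trans p≤s s<P))) (∈-upTo⁺ (s≤s p≤s)))
    hit : ∀ {i} → i < P → Any (λ x → (i + (s ∸ x)) % P ∈ R) S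
    hit {zero}  _ = lose x₀∈S (low y₀≤s)
    hit {i@(suc _)} i<P with i ≤? n
    ... | yes i≤n with cov i (s≤s z≤n) i≤n
    ...   | t , x , t∈T , x∈S , eq = lose x∈S (subst (_∈ R) (sym p%P≡)
              (∈-++⁺ʳ A₁ (∈-++⁺ʳ A₂ (∈-map⁺ (λ t → ℤ.∣ t ℤ.+ + s ∣) t∈T))))
      where
      p%P≡ : (i + (s ∸ x)) % P ≡ ℤ.∣ t ℤ.+ + s ∣
      p%P≡ = trans (m<n⇒m%n≡m (s≤s (+-mono-≤ i≤n (m∸n≤m s x))))
                   (sym (cong ℤ.∣_∣ (toPosition t x i (All.lookup bounded x∈S) eq)))
    hit {i@(suc _)} i<P | no i≰n with i + y₀ <? P
    ... | yes p<P = lose x₀∈S (subst (_∈ R) eq (∈-++⁺ʳ A₁ (∈-++⁺ˡ (∈-map⁺ shiftUp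
            (∈-upTo⁺ (+-cancelˡ-< (suc n) _ _ (subst (_< P) (sym n+≡) p<P)))))))
      where
      n+≡ : suc n + (i + y₀ ∸ suc n) ≡ i + y₀
      n+≡ = m+[n∸m]≡n (≤-trans (≰⇒> i≰n) (m≤m+n i y₀))
      eq : suc n + (i + y₀ ∸ suc n) ≡ (i + y₀) % P
      eq = trans n+≡ (sym (m<n⇒m%n≡m p<P))
    ... | no p≮P = lose x₀∈S (subst (_∈ R) (m≤n⇒[n∸m]%m≡n%m (≮⇒≥ p≮P))
            (low (≤-trans (m≤n+o⇒m∸n≤o (i + y₀) P (+-monoˡ-≤ y₀ (<⇒≤ i<P))) y₀≤s)))

  periodic⇒finite : ∀ {L c} .{{_ : NonZero L}} (T : Covering L c) n →
    ∃ λ U → Unique U × CoversUpTo S n U × length U * L ≤ count (indicator T) L * (n + s + L)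
  periodic⇒finite {L} T n = U , unique-U , cov , bound
    where
    α = indicator T
    -- So many whole periods contain every position up to `n + s`, the last one that an integer up
    -- to `n` can use.
    k = suc ((n + s) / L)
    toℤ : ℕ → ℤ
    toℤ p = + p ℤ.- + s
    U = map toℤ (support α (k * L))
    unique-U : Unique U
    unique-U = map⁺ (λ {p} {q} eq → ℤ.+-injective (ℤ-+-cancelʳ (ℤ.- + s) (+ p) (+ q) eq))
                    (filter⁺ (λ i → α i ≟ᵇ true) (upTo⁺ (k * L)))
    n+s<kL : n + s < k * L
    n+s<kL = subst (_< k * L) (sym (m≡m%n+[m/n]*n (n + s) L)) (+-monoˡ-< ((n + s) / L * L) (m%n<n (n + s) L))
    cov : CoversUpTo S n U
    cov i _ i≤n with covers T i
    ... | x , x∈S , eq = toℤ (i + (s ∸ x)) , x ,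
      ∈-map⁺ toℤ (∈-filter⁺ (λ i → α i ≟ᵇ true) (∈-upTo⁺ (≤-<-trans (+-mono-≤ i≤n (m∸n≤m s x)) n+s<kL)) eq) ,
      x∈S , fromPosition x i (All.lookup bounded x∈S)
    bound : length U * L ≤ count α L * (n + s + L)
    bound = begin
      length U * L                     ≡⟨ cong (_* L) (trans (length-map toℤ (support α (k * L))) (length-support α (k * L))) ⟩
      count α (k * L) * L              ≡⟨ cong (_* L) (sumBelow-periods L (bit ∘ α) (cong bit ∘ periodic T) k) ⟩
      k * count α L * L                ≡⟨ rearrange k (count α L) L ⟩
      count α L * (k * L)              ≤⟨ *-monoʳ-≤ (count α L) (+-monoʳ-≤ L (m/n*n≤m (n + s) L)) ⟩
      count α L * (L + (n + s))        ≡⟨ cong (count α L *_) (+-comm L (n + s)) ⟩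
      count α L * (n + s + L)          ∎
      where
      open ≤-Reasoning
      rearrange : ∀ a b c → a * b * c ≡ b * (a * c)
      rearrange = solve-∀

  open Optimum.Optimal opt public

  -- If no covering had minimum size, strong induction on the size would exclude coverings of every
  -- size, but `periodic⇒finite` provides one.
  tauN-attained : ∀ n → ¬ ¬ ∃ (IsTauN S n)
  tauN-attained n none with periodic⇒finite T n
  ... | U , u , cov , _ = <-rec (λ m → ∀ U → Unique U → CoversUpTo S n U → length U ≢ m) step (length U) U u cov refl
    where
    step : ∀ m → (∀ {m′} → m′ < m → ∀ U → Unique U → CoversUpTo S n U → length U ≢ m′) →
           ∀ U → Unique U → CoversUpTo S n U → length U ≢ m
    step m rec U u cov eq = none (m , (U , u , cov , eq) , λ V v covV → ≮⇒≥ λ V<m → rec V<m V v covV refl)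

  tau : ℚ
  tau = fraction c L

  -- `m * L` stays within a constant of `c * n`: from below by closing an arbitrary finite covering,
  -- where `K₁` pays for the `2s + 1` seam positions; from above by restricting `T`, where `K₂` pays
  -- for the positions beyond `n`.
  isTau : IsTau S tau
  isTau ε 0<ε with reciprocal-below ε 0<ε
  ... | q , nz , 1/q≤ε = K * q , λ n Kq≤n nzn m τₙ →
      ℚ.≤-trans (fraction-close m n c L K q {{nzn}} {{nonZeroL}} {{nz}} (upper n m τₙ) (lower n m τₙ) Kq≤n) 1/q≤ε
    where
    open ≤-Reasoning
    K₁ = (suc s + s) * L
    K₂ = c * (s + L)
    K = K₁ + K₂
    lower : ∀ n m → IsTauN S n m → c * n ≤ m * L + K
    lower n m ((T , _ , cov , refl) , _) = begin
      c * n                              ≤⟨ *-monoʳ-≤ c (≤-trans (n≤1+n n) (m≤m+n (suc n) s)) ⟩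
      c * (suc n + s)                    ≤⟨ best (suc n + s) _ (finite⇒periodic n T cov) ⟩
      (suc s + (s + length T)) * L       ≡⟨ rearrange (suc s) s (length T) L ⟩
      length T * L + K₁                  ≤⟨ +-monoʳ-≤ (length T * L) (m≤m+n K₁ K₂) ⟩
      length T * L + K                   ∎
      where
      rearrange : ∀ a b d l → (a + (b + d)) * l ≡ d * l + (a + b) * l
      rearrange = solve-∀
    upper : ∀ n m → IsTauN S n m → m * L ≤ c * n + K
    upper n m (_ , min) with periodic⇒finite T n
    ... | U , u , cov , bound = begin
      m * L                                    ≤⟨ *-monoˡ-≤ L (min U u cov) ⟩
      length U * L                             ≤⟨ bound ⟩
      count (indicator T) L * (n + s + L)      ≡⟨ cong (_* (n + s + L)) c≡count ⟨
      c * (n + s + L)                          ≡⟨ rearrange c n s L ⟩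
      c * n + K₂                               ≤⟨ +-monoʳ-≤ (c * n) (m≤n+m K₂ K₁) ⟩
      c * n + K                                ∎
      where
      rearrange : ∀ a b d l → a * (b + d + l) ≡ a * b + a * (d + l)
      rearrange = solve-∀

  tau-unique : ∀ r → IsTau S r → r ≡ tau
  tau-unique r h = IsTau-unique S r tau tauN-attained h isTau

  -- The least period ℓ(S)

  optimalSet : PeriodicSet L
  optimalSet = record
    { residues = support (indicator T) L
    ; unique   = filter⁺ (λ i → indicator T i ≟ᵇ true) (upTo⁺ L)
    ; bounded  = All.tabulate λ i∈ → ∈-upTo⁻ (proj₁ (∈-filter⁻ (λ i → indicator T i ≟ᵇ true) {xs = upTo L} i∈))
    }

  -- The residues are positions that are not moved back by `s`, so the set is a translate of the one
  -- that `T` encodes. Hence `z` is looked up as the integer `z − s`: indeed z - x = (z - s) + (s -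
  -- x).
  optimalSet-covers : PCovers S optimalSet
  optimalSet-covers z with covers T ((z ℤ.- + s) %ℕ L)
  ... | x , x∈S , eq = z ℤ.- + x , x , member , x∈S , cancel z (+ x)
    where
    open ≡-Reasoning
    r = (z ℤ.- + s) %ℕ L
    k = (z ℤ.- + s) /ℕ L
    p = r + (s ∸ x)
    cancel : ∀ a b → a ℤ.- b ℤ.+ b ≡ a
    cancel = ℤSolver.solve-∀
    regroup₁ : ∀ z a b → z ℤ.- b ≡ z ℤ.- (a ℤ.+ b) ℤ.+ a
    regroup₁ = ℤSolver.solve-∀
    regroup₂ : ∀ a b c → a ℤ.+ b ℤ.+ c ≡ a ℤ.+ c ℤ.+ b
    regroup₂ = ℤSolver.solve-∀
    z-x≡ : z ℤ.- + x ≡ + p ℤ.+ k ℤ.* + L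
    z-x≡ = begin
      z ℤ.- + x                                 ≡⟨ regroup₁ z (+ (s ∸ x)) (+ x) ⟩
      z ℤ.- + (s ∸ x + x) ℤ.+ + (s ∸ x)         ≡⟨ cong (λ n → z ℤ.- + n ℤ.+ + (s ∸ x)) (m∸n+n≡m (All.lookup bounded x∈S)) ⟩
      z ℤ.- + s ℤ.+ + (s ∸ x)                   ≡⟨ cong (ℤ._+ + (s ∸ x)) (a≡a%ℕn+[a/ℕn]*n (z ℤ.- + s) L) ⟩
      + r ℤ.+ k ℤ.* + L ℤ.+ + (s ∸ x)           ≡⟨ regroup₂ (+ r) (k ℤ.* + L) (+ (s ∸ x)) ⟩
      + p ℤ.+ k ℤ.* + L                         ∎
    member : (z ℤ.- + x) %ℕ L ∈ support (indicator T) L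
    member = subst (_∈ support (indicator T) L)
      (sym (trans (cong (_%ℕ L) z-x≡) ([n+kL]%ℕL p k L)))
      (∈-filter⁺ (λ i → indicator T i ≟ᵇ true) (∈-upTo⁺ (m%n<n p L)) (trans (periodic-% T p) eq))

  periodicSet⇒covering : ∀ {P} {{_ : NonZero P}} (R : PeriodicSet P) → PCovers S R → Covering P (length (residues R))
  periodicSet⇒covering {P} R cov = fromPositions P (residues R) hit
    where
    hit : ∀ {i} → i < P → Any (λ x → (i + (s ∸ x)) % P ∈ residues R) S
    hit {i} _ with cov (+ (i + s))
    ... | t , x , t∈ , x∈S , eq = lose x∈S (subst (λ z → z %ℕ P ∈ residues R) t≡ t∈)
      where
      commute : ∀ a b c → a + b + c ≡ a + c + b
      commute = solve-∀
      t≡ : t ≡ + (i + (s ∸ x))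
      t≡ = ℤ-+-cancelʳ (+ s) t (+ (i + (s ∸ x)))
        (trans (toPosition t x (i + s) (All.lookup bounded x∈S) eq) (cong +_ (commute i s (s ∸ x))))

  isEll : IsEll S L
  isEll = (nonZeroL , optimalSet , optimalSet-covers , subst (IsTau S) tau≡ isTau) , smallest
    where
    tau≡ : tau ≡ density optimalSet
    tau≡ = cong (λ n → fraction n L) (trans c≡count (sym (length-support (indicator T) L)))
    smallest : ∀ P → HasOptimalPeriod S P → L ≤ P
    smallest P (nz , R , cov , τR) = minimal P _ (>-nonZero⁻¹ P {{nz}}) (periodicSet⇒covering {{nz}} R cov)
      (≤-reflexive (fraction-injective (length (residues R)) P c L {{nz}} (tau-unique (density {{nz}} R) τR)))

  -- Every t up to `m` is at most 2sτ and passes the test in the sum, so no binomial coefficient is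
  -- replaced by 0.
  ballSize≤partialSum : ∀ m → m * L ≤ 2 * (s * c) → ballSize s m ≤ partialSum s tau m
  ballSize≤partialSum m mL≤ = go m mL≤
    where
    light : ∀ t → t * L ≤ 2 * (s * c) → LightWeight s tau t
    light t tL≤ = subst (fraction t 1 ℚ.≤_) (sym (fraction-* (2 * s) c L))
      (fraction-≤ t 1 (2 * s * c) L (≤-trans tL≤ (≤-reflexive (trans (sym (*-assoc 2 s c)) (sym (*-identityʳ _))))))
    go : ∀ t → t * L ≤ 2 * (s * c) → ballSize s t ≤ partialSum s tau t
    go zero    h = ≤-reflexive (trans (ballSize-zero s) (sym (partialSum-zero s tau (light 0 h))))
    go (suc t) h = ≤-trans
      (≤-trans (≤-reflexive (ballSize-suc s t)) (+-monoʳ-≤ (s C suc t) (go t (≤-trans (m≤n+m (t * L) L) h))))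
      (≤-reflexive (sym (partialSum-suc s tau t (light (suc t) h))))

  private
    m = threshold T

    m*L≤ : m * L ≤ 2 * (s * c)
    m*L≤ = subst (λ n → m * L ≤ 2 * (s * n)) (sym c≡count) (threshold*P≤ T)

  L≤2*binomSum : 1 ≤ s → L ≤ 2 * binomSumUpTo s tau
  L≤2*binomSum 1≤s = ≤-trans (period≤2*ballSize T 1≤s ¬recurrence) (*-monoʳ-≤ 2
    (≤-trans (ballSize≤partialSum m m*L≤) (partialSum-mono s tau (m⊓n≤m s _))))

  -- The exponent 7 is 2 + 5: Markov's factor 2 contributes `2 ^ j`, where j ≤ |S| ≤ s + 1 ≤ 2s, and
  -- the ball contributes `2 ^ (5 * s)`. The fourth root comes from `q * q ≤ length S` with
  -- `q = j * j`: then τ ≤ 2/q, so the threshold is at most 4s/q.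
  L^root4≤ : 1 ≤ s → Unique S → L ^ root4 (length S) ≤ 2 ^ (s * 7)
  L^root4≤ 1≤s unique = begin
    L ^ j                          ≤⟨ ^-monoˡ-≤ j (period≤2*ballSize T 1≤s ¬recurrence) ⟩
    (2 * ballSize s m) ^ j         ≡⟨ ^-distribʳ-* 2 (ballSize s m) j ⟩
    2 ^ j * ballSize s m ^ j       ≤⟨ *-mono-≤ (^-monoʳ-≤ 2 j≤2s) (ballSize^j≤ s m j 1≤j qm≤4s) ⟩
    2 ^ (2 * s) * 2 ^ (5 * s)      ≡⟨ ^-distribˡ-+-* 2 (2 * s) (5 * s) ⟨
    2 ^ (2 * s + 5 * s)            ≡⟨ cong (2 ^_) (seven s) ⟩
    2 ^ (s * 7)                    ∎
    where
    open ≤-Reasoning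
    open SparseCovering S s unique bounded
    seven : ∀ s → 2 * s + 5 * s ≡ s * 7
    seven = solve-∀
    fourth : ∀ a → a * a * (a * a) ≡ a * (a * (a * (a * 1)))
    fourth = solve-∀
    j = root4 (length S)
    q = j * j
    1≤j : 1 ≤ j
    1≤j = root4-positive (length S)
    j⁴≤k : j ^ 4 ≤ length S
    j⁴≤k with length S | ∈-length x₀∈S
    ... | suc k | _ = root4-lower k
    k≤1+s : length S ≤ suc s
    k≤1+s = ≤-trans (injection⇒length-≤ id unique (λ x∈S → ∈-upTo⁺ (s≤s (All.lookup bounded x∈S))) λ _ _ eq → eq)
                    (≤-reflexive (length-upTo (suc s)))
    j≤2s : j ≤ 2 * s
    j≤2s = begin
      j          ≡⟨ ^-identityʳ j ⟨
      j ^ 1      ≤⟨ ^-monoʳ-≤ j {{>-nonZero 1≤j}} {1} {4} (s≤s z≤n) ⟩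
      j ^ 4      ≤⟨ j⁴≤k ⟩
      length S   ≤⟨ k≤1+s ⟩
      1 + s      ≤⟨ +-monoˡ-≤ s 1≤s ⟩
      s + s      ≡⟨ cong (λ n → s + n) (+-identityʳ s) ⟨
      2 * s      ∎
    sparse = sparseCovering x₀∈S q (*-mono-≤ 1≤j 1≤j) (≤-trans (≤-reflexive (fourth j)) j⁴≤k)
    c′ = proj₁ sparse
    q*c≤2L : q * c ≤ 2 * L
    q*c≤2L = *-cancelʳ-≤ _ _ (suc s) (begin
      q * c * suc s        ≡⟨ *-assoc q c (suc s) ⟩
      q * (c * suc s)      ≤⟨ *-monoʳ-≤ q (best (suc s) c′ (proj₁ (proj₂ sparse))) ⟩
      q * (c′ * L)         ≡⟨ *-assoc q c′ L ⟨
      q * c′ * L           ≤⟨ *-monoˡ-≤ L (proj₂ (proj₂ sparse)) ⟩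
      2 * suc s * L        ≡⟨ swap 2 (suc s) L ⟩
      2 * L * suc s        ∎)
      where
      swap : ∀ a b d → a * b * d ≡ a * d * b
      swap = solve-∀
    qm≤4s : q * m ≤ 4 * s
    qm≤4s = *-cancelʳ-≤ _ _ L (begin
      q * m * L            ≡⟨ *-assoc q m L ⟩
      q * (m * L)          ≤⟨ *-monoʳ-≤ q m*L≤ ⟩
      q * (2 * (s * c))    ≡⟨ regroup q s c ⟩
      2 * s * (q * c)      ≤⟨ *-monoʳ-≤ (2 * s) q*c≤2L ⟩
      2 * s * (2 * L)      ≡⟨ four s L ⟩
      4 * s * L            ∎)
      where
      regroup : ∀ a b d → a * (2 * (b * d)) ≡ 2 * b * (a * d)
      regroup = solve-∀
      four : ∀ a b → 2 * a * (2 * b) ≡ 4 * a * b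
      four = solve-∀

IsEll-unique : ∀ {S L L′} → IsEll S L → IsEll S L′ → L ≡ L′
IsEll-unique (h , min) (h′ , min′) = ≤-antisym (min _ h′) (min′ _ h)

nonempty : ∀ {S : List ℕ} → ¬ S ≡ [] → ∃ λ x → x ∈ S
nonempty {[]}    ne = contradiction refl ne
nonempty {x ∷ _} _  = x , here refl

theorem5p2 : (∀ (s : ℕ) → 1 ≤ s → ∀ (S : List ℕ) → IsShape s S →
    Σ ℕ λ L → IsEll S L × L ≤ 2 ^ s
    × (∀ (r : ℚ) → IsTau S r → L ≤ 2 * binomSumUpTo s r))
    × (Σ (ℕ → ℕ × ℕ) λ f →
    (∀ k → NonZero (proj₂ (f k)))
    × (∀ (p q : ℕ) → 1 ≤ p → 1 ≤ q →
    Σ ℕ λ K → ∀ k → K ≤ k → proj₁ (f k) * q ≤ p * proj₂ (f k))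
    × (∀ (s : ℕ) → 1 ≤ s → ∀ (S : List ℕ) → IsShape s S → ∀ (L : ℕ) → IsEll S L →
    L ^ proj₂ (f (length S)) ≤ 2 ^ (s * proj₁ (f (length S)))))
theorem5p2 = bounds , f , (λ k → >-nonZero (root4-positive k)) , vanishes , power
  where
  bounds : ∀ s → 1 ≤ s → ∀ S → IsShape s S →
    Σ ℕ λ L → IsEll S L × L ≤ 2 ^ s × (∀ r → IsTau S r → L ≤ 2 * binomSumUpTo s r)
  bounds s 1≤s S (_ , bounded , ne) = L , isEll , L≤2^s ,
      λ r τ → subst (λ r → L ≤ 2 * binomSumUpTo s r) (sym (tau-unique r τ)) (L≤2*binomSum 1≤s)
    where
    x₀∈S = proj₂ (nonempty ne)
    open Density S s bounded x₀∈S (Coverings.Optimum.optimal S s x₀∈S)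
  f : ℕ → ℕ × ℕ
  -- The pair stands for the fraction 7 / `root4 k`; the bound on ℓ(S) is accordingly stated after
  -- raising it to the power of the denominator.
  f k = 7 , root4 k
  vanishes : ∀ p q → 1 ≤ p → 1 ≤ q → Σ ℕ λ K → ∀ k → K ≤ k → 7 * q ≤ p * root4 k
  -- From `(7 * q) ^ 4` on, the fourth root is at least `7 * q`.
  vanishes p q 1≤p _ = (7 * q) ^ 4 , λ k K≤k → ≤-trans
    (≮⇒≥ λ r<7q → <⇒≱ (root4-upper k) (≤-trans (^-monoˡ-≤ 4 r<7q) K≤k))
    (m≤n*m (root4 k) p {{>-nonZero 1≤p}})
  power : ∀ s → 1 ≤ s → ∀ S → IsShape s S → ∀ L → IsEll S L → L ^ root4 (length S) ≤ 2 ^ (s * 7)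
  power s 1≤s S (unique , bounded , ne) L′ ell =
      subst (λ L → L ^ root4 (length S) ≤ 2 ^ (s * 7)) (IsEll-unique isEll ell) (L^root4≤ 1≤s unique)
    where
    x₀∈S = proj₂ (nonempty ne)
    open Density S s bounded x₀∈S (Coverings.Optimum.optimal S s x₀∈S)
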